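{- Let $G$ be an undirected, loopless, connected graph (multiple edges allowed) on the vertex set $\{0,1,\ldots,n\}$. Then the polynomial $P_G(x) = \sum_{(a_1,\ldots,a_n)} x^{a_1 + \cdots + a_n}$, where the sum ranges over all $G$-parking functions $(a_1,\ldots,a_n)$, is log-concave.
   Context: For $I \subseteq \{1,\ldots,n\}$ and $i \in I$, let $d_I(i)$ be the number of edges of $G$ between vertex $i$ and vertices not in $I$ (counted with multiplicity). A $G$-parking function is a sequence $(a_1,\ldots,a_n)$ of positive integers such that for every nonempty subset $I \subseteq \{1,\ldots,n\}$ there exists $i \in I$ with $a_i \leq d_I(i)$. A polynomial is called log-concave if its sequence of coefficients $a_0, a_1, \ldots, a_d$ satisfies $a_i^2 \geq a_{i-1}a_{i+1}$ for all $0 < i < d$. -}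

module Defs where

open import Data.Nat using (ℕ; zero; suc; _+_; _*_; _≤_; _≤?_)
open import Data.Nat.Properties using (_≟_)
open import Data.Fin using (Fin; zero; suc)
open import Data.Fin.Properties using (all?; any?)
open import Data.Fin.Subset using (Subset; _∈_; Nonempty)
open import Data.Fin.Subset.Properties using (_∈?_; nonempty?; anySubset?)
open import Data.Vec using (Vec; []; _∷_; lookup; tabulate)
import Data.Vec as Vec
open import Data.List using (List; []; _∷_; map; concatMap; upTo; length; filter)
open import Data.Bool using (if_then_else_)
open import Data.Product using (Σ; ∃; _×_; _,_)
open import Relation.Binary.PropositionalEquality using (_≡_)
open import Relation.Nullary using (Dec; yes; no; ¬_; ¬?)
open import Relation.Nullary.Decidable using (_×-dec_; _→-dec_; decidable-stable)
open import Relation.Unary using (Pred; Decidable)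
import Level

record Multigraph (n : ℕ) : Set where
  field
    mult      : Fin (suc n) → Fin (suc n) → ℕ
    symmetric : ∀ u v → mult u v ≡ mult v u
    loopless  : ∀ v → mult v v ≡ 0

open Multigraph public

data Reach {n : ℕ} (G : Multigraph n) : Fin (suc n) → Fin (suc n) → Set where
  here : ∀ {v} → Reach G v v
  step : ∀ {u w v} → 1 ≤ mult G u w → Reach G w v → Reach G u v

Connected : ∀ {n} → Multigraph n → Set
Connected G = ∀ u v → Reach G u v

-- G-parking functions.  A sequence (a_1,…,a_n) is a Vec ℕ n, entry at
-- index i : Fin n being a_{i+1} (the value at vertex suc i).
-- A subset I ⊆ {1,…,n} is a Subset n (j ∈ I  means vertex suc j ∈ I).

-- d_I(i): number of edges between vertex i and vertices not in I
-- (vertex 0 is never in I).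
dOut : ∀ {n} → Multigraph n → Subset n → Fin n → ℕ
dOut G I i = mult G (suc i) zero
           + Vec.sum (tabulate λ j → if lookup I j then 0 else mult G (suc i) (suc j))

IsParking : ∀ {n} → Multigraph n → Vec ℕ n → Set
IsParking {n} G a =
  (∀ i → 1 ≤ lookup a i) ×
  (∀ (I : Subset n) → Nonempty I → ∃ λ i → i ∈ I × lookup a i ≤ dOut G I i)

allSubset? : ∀ {n} {Q : Pred (Subset n) Level.zero} → Decidable Q → Dec (∀ I → Q I)
allSubset? Q? with anySubset? (λ I → ¬? (Q? I))
... | yes (I , ¬q) = no (λ h → ¬q (h I))
... | no ¬e = yes (λ I → decidable-stable (Q? I) (λ ¬q → ¬e (I , ¬q)))

parking? : ∀ {n} (G : Multigraph n) → Decidable (IsParking G)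
parking? G a =
  all? (λ i → 1 ≤? lookup a i) ×-dec
  allSubset? (λ I → nonempty? I →-dec
                    any? (λ i → (i ∈? I) ×-dec (lookup a i ≤? dOut G I i)))

-- Finite candidate set: every G-parking function satisfies
-- 1 ≤ a_i ≤ d_{{i}}(i) = deg(i) (take I = {i}; G loopless), so all of
-- them lie among the vectors with 1 ≤ a_i ≤ deg(i).

deg : ∀ {n} → Multigraph n → Fin n → ℕ
deg G i = Vec.sum (tabulate λ w → mult G (suc i) w)

boxVecs : ∀ n → (Fin n → ℕ) → List (Vec ℕ n)
boxVecs zero    b = [] ∷ []
boxVecs (suc n) b =
  concatMap (λ x → map (x ∷_) (boxVecs n (λ i → b (suc i)))) (map suc (upTo (b zero)))

coeffP : ∀ {n} → Multigraph n → ℕ → ℕ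
coeffP {n} G k =
  length (filter (λ a → parking? G a ×-dec (Vec.sum a ≟ k)) (boxVecs n (deg G)))

-- log-concavity of the coefficient sequence (c_k)_{k ≥ 0} (finitely
-- supported): c_{k-1} c_{k+1} ≤ c_k² for all k ≥ 1.  Indices beyond the
-- degree give 0 on the left, so this is the same as 0 < i < d.
LogConcave : (ℕ → ℕ) → Set
LogConcave c = ∀ k → c k * c (suc (suc k)) ≤ c (suc k) * c (suc k)

{-# OPTIONS --safe #-}
module Submission where

-- Removing or contracting an edge at the root shows that the number of G-parking functions
-- of degree k satisfies the deletion–contraction recursion of the coefficients of T_G(1, y)
-- (Enumeration), so the theorem is about h-vectors of cographic matroids.
--
-- These numbers are intersection numbers A^i B^j of two divisor classes.  Adjoin a class Z f
-- for every edge f, with Z f given by contraction of f.  On the span of A, B and the Z f there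
-- is for each k an intersection form, and the deletion–contraction recursion lifts to the
-- forms: Q = Q₁ + Q₂, the forms of the deletion and of the contraction.  The Hodge index
-- inequality Q(B,B) Q(x,x) ≤ Q(B,x)² passes from Q₁ and Q₂ to Q (hodge-link), because
-- p = B − Z f and q = Z f satisfy p + q = B and Q₁(q,x) = Q₂(p,x).  The case x = A is
-- log-concavity.
--
-- The gluing needs strict positivity, so the recursion is started not from the indicator of
-- the full flat in degree 0 but from T^(rank of the flat − degree); the wanted numbers are the leading
-- coefficients as T → ∞.

open import Defs
open import Data.Nat using (ℕ)
open import Data.Bool.Base using (true; false; if_then_else_)
open import Data.Empty using (⊥)
open import Data.Fin.Base using (Fin; zero; suc)
open import Data.Fin.Properties using (suc-injective; all?; ¬∀⟶∃¬) renaming (_≟_ to _≟ᶠ_)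
open import Data.Fin.Subset using (Subset; inside; outside; _∈_; _∉_; _⊆_; Nonempty; ∣_∣; ∁; ⁅_⁆) renaming (⊥ to ∅)
open import Data.Fin.Subset.Properties using (_∈?_; x∈⁅x⁆; x∈⁅y⁆⇒x≡y; ∣⁅x⁆∣≡1; ∣∁p∣≡n∸∣p∣; x∉p⇒x∈∁p; x∈∁p⇒x∉p; p⊆q⇒∣p∣≤∣q∣; p⊂q⇒∣p∣<∣q∣; ∉⊥; ∣⊥∣≡0)
open import Data.Integer.Base hiding (suc; pred; ∣_∣)
open import Data.Integer.Properties
open import Data.Integer.Tactic.RingSolver using (solve-∀)
open import Data.List.Base using (List; []; _∷_; _++_; map; replicate; length; filter; concatMap)
open import Data.List.Membership.Propositional using (find; lose) renaming (_∈_ to _∈ˡ_)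
open import Data.List.Membership.Propositional.Properties using (∈-map⁺; ∈-map⁻; ∈-++⁺ˡ; ∈-++⁺ʳ; ∈-++⁻; ∈-∃++; ∈-concatMap⁺; ∈-concatMap⁻; ∈-upTo⁺; ∈-filter⁺; ∈-filter⁻)
open import Data.List.Membership.Propositional.Properties.WithK using (unique∧set⇒bag)
open import Data.List.Properties using (map-++; map-∘; length-++; length-map)
open import Data.List.Relation.Binary.BagAndSetEquality using (∼bag⇒↭)
open import Data.List.Relation.Binary.Permutation.Propositional.Properties using (↭-length)
open import Data.List.Relation.Unary.All as All using (All; []; _∷_)
open import Data.List.Relation.Unary.All.Properties using (¬Any⇒All¬)
open import Data.List.Relation.Unary.AllPairs using (AllPairs; []; _∷_)
open import Data.List.Relation.Unary.Any as Any using (Any; here; there)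
open import Data.List.Relation.Unary.Unique.Propositional using (Unique)
import Data.List.Relation.Unary.Unique.Propositional.Properties as Unique
open import Data.Nat.Base as ℕ using (zero; suc)
open import Data.Nat.ListAction using (sum)
open import Data.Nat.ListAction.Properties using (sum-++)
import Data.Nat.Properties as ℕ
open import Algebra.Properties.CommutativeSemigroup ℕ.+-commutativeSemigroup using (x∙yz≈y∙xz)
open import Data.Product using (_×_; _,_; proj₁; proj₂; ∃)
open import Data.Sum.Base using (_⊎_; inj₁; inj₂; [_,_]′)
open import Data.Vec.Base as Vec using (Vec; []; _∷_; here; there; _[_]≔_; lookup; tabulate; updateAt)
open import Data.Vec.Properties using (∷-injective; ∷-injectiveʳ; []≔-updates; []≔-minimal; lookup∘updateAt; lookup∘updateAt′; updateAt-updateAt-local; updateAt-id-local; lookup-replicate; lookup∘tabulate; []=⇒lookup; lookup⇒[]=)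
open import Function using (id; _∘_)
open import Function.Bundles using (mk⇔)
open import Relation.Binary.PropositionalEquality
open import Relation.Nullary using (Dec; yes; no; ¬_; ¬?; contradiction; does)
open import Relation.Nullary.Decidable using (_×-dec_; _⊎-dec_)

-- Log-concavity alone does not survive the recursion, since a sum of two log-concave sequences need
-- not be log-concave. The inequality for all x in the span leaves room: to obtain it at x for Q, it
-- is used for `Q₁` and `Q₂` at a shifted vector y. The shift is along the combination of p and q
-- that is Q-orthogonal to B, a direction whose pairings with B are known numbers. It involves `Z f`
-- for the edge f being glued, so the span has to contain the classes of all edges. That `Z f` acts
-- as B - A where f is a loop is forced: only so does it commute with deletion-contraction at an
-- element parallel to f. A loop acts as the identity in the recursion because the degree of a
-- parking function counts downwards from the top power of y in T_G(1, y), and a loop raises that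
-- power by one. At the start of the recursion the form is explicit: on T^(rank - degree) each class
-- acts as a combination of A and B, up to a correction for pairs of parallel elements, which is a
-- negative multiple of a Gram form.

-- Gluing two quadratic forms

0≤i*i : ∀ i → 0ℤ ≤ i * i
0≤i*i (+ n) = subst (0ℤ ≤_) (pos-* n n) (+≤+ ℕ.z≤n)
0≤i*i -[1+ n ] = +≤+ ℕ.z≤n

0<i*j : ∀ {i j} → 0ℤ < i → 0ℤ < j → 0ℤ < i * j
0<i*j {i} {j} 0<i 0<j =
  subst (_< i * j) (*-zeroʳ i) (*-monoˡ-<-pos i {{positive 0<i}} 0<j)

0≤i*j : ∀ {i j} → 0ℤ ≤ i → 0ℤ ≤ j → 0ℤ ≤ i * j
0≤i*j {i} {j} 0≤i 0≤j =
  subst (_≤ i * j) (*-zeroʳ i) (*-monoˡ-≤-nonNeg i {{nonNegative 0≤i}} 0≤j)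

private
  -- For y = μ x + λ' (b p - a q), the left side compares the sum of the two Hodge inequalities at
  -- y, weighted by b and a, and the right side is the wanted inequality at x plus a remainder
  -- quadratic in (λ', μ), which the choice of y has to make nonnegative.
  expansion : ∀ a b c u v X λ' μ →
    let s = a + b ; D = b * u - a * v ; e = c * s - a * b in
    s * (a * b * (μ * μ * X + (1ℤ + 1ℤ) * μ * λ' * D - λ' * λ' * s * e)
         - (b * ((μ * u - λ' * e) * (μ * u - λ' * e)) + a * ((μ * v + λ' * e) * (μ * v + λ' * e))))
    ≡ μ * μ * (a * b) * (s * X - (u + v) * (u + v))
      + ((1ℤ + 1ℤ) * λ' * μ * D * c * (s * s) - μ * μ * (D * D) - λ' * λ' * (s * s) * e * (c * s))
  expansion = solve-∀

  -- The choice λ' = D, μ = c s². The stationary ratio λ'/μ of the remainder is D/(s e), but e is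
  -- not known to be positive. With the ratio D/(c s²) the remainder is μ² D² (1 - e/(c s)), and e ≤
  -- c s always holds, as e = c s - p with p = a b.
  optimum : ∀ c s D p →
    let μ = c * (s * s) ; e = c * s - p in
    (1ℤ + 1ℤ) * D * μ * D * c * (s * s) - μ * μ * (D * D) - D * D * (s * s) * e * (c * s)
    ≡ D * D * (s * s * s * c * p)
  optimum = solve-∀

  nonpos : ∀ {p w y r} → 0ℤ < p → 0ℤ ≤ w → p * y + w ≡ r → r ≤ 0ℤ → y ≤ 0ℤ
  nonpos {p} {w} {y} 0<p 0≤w eq r≤0 = *-cancelˡ-≤-pos y 0ℤ p {{positive 0<p}} (begin
    p * y      ≡⟨ +-identityʳ _ ⟨
    p * y + 0ℤ ≤⟨ +-monoʳ-≤ (p * y) 0≤w ⟩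
    p * y + w  ≡⟨ eq ⟩
    _          ≤⟨ r≤0 ⟩
    0ℤ         ≡⟨ *-zeroʳ p ⟨
    p * 0ℤ     ∎)
    where open ≤-Reasoning

-- In terms of forms: a and b are the two values at (B,B), u and v those at (B,x), c that of the
-- first form at (B,q) and of the second at (B,p), and X = Q(x,x). The arguments `Q₁`, `Q₂` are the
-- values of the two forms at y = μ x + D z, where z = b p - a q. One has Q(B,z) = 0, Q(x,z) = D and
-- Q(z,z) = - s e, while the pairings of B with z under the two forms are - e and e. This accounts
-- for both bounds and for the expansion of `Q₁ + Q₂`.
glue : ∀ {a b c} u v X Q₁ Q₂ → 0ℤ < a → 0ℤ < b → 0ℤ < c →
  let s = a + b ; D = b * u - a * v ; e = c * s - a * b ; μ = c * (s * s) in
  a * Q₁ ≤ (μ * u - D * e) * (μ * u - D * e) →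
  b * Q₂ ≤ (μ * v + D * e) * (μ * v + D * e) →
  Q₁ + Q₂ ≡ μ * μ * X + (1ℤ + 1ℤ) * μ * D * D - D * D * s * e →
  s * X ≤ (u + v) * (u + v)
glue {a} {b} {c} u v X Q₁ Q₂ 0<a 0<b 0<c le₁ le₂ eq =
  i-j≤0⇒i≤j (nonpos 0<p 0≤w identity upper)
  where
  s = a + b
  D = b * u - a * v
  e = c * s - a * b
  μ = c * (s * s)
  P₁ = μ * u - D * e
  P₂ = μ * v + D * e
  0<s : 0ℤ < s
  0<s = +-mono-< 0<a 0<b
  0<μ : 0ℤ < μ
  0<μ = 0<i*j 0<c (0<i*j 0<s 0<s)
  0<p : 0ℤ < μ * μ * (a * b)
  0<p = 0<i*j (0<i*j 0<μ 0<μ) (0<i*j 0<a 0<b)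
  0≤w : 0ℤ ≤ D * D * (s * s * s * c * (a * b))
  0≤w = 0≤i*j (0≤i*i D) (<⇒≤ (0<i*j (0<i*j (0<i*j (0<i*j 0<s 0<s) 0<s) 0<c) (0<i*j 0<a 0<b)))
  identity : μ * μ * (a * b) * (s * X - (u + v) * (u + v)) + D * D * (s * s * s * c * (a * b))
           ≡ s * (a * b * (Q₁ + Q₂) - (b * (P₁ * P₁) + a * (P₂ * P₂)))
  identity = begin
    _ ≡⟨ cong (λ t → μ * μ * (a * b) * (s * X - (u + v) * (u + v)) + t) (optimum c s D (a * b)) ⟨
    _ ≡⟨ expansion a b c u v X D μ ⟨
    _ ≡⟨ cong (λ q → s * (a * b * q - (b * (P₁ * P₁) + a * (P₂ * P₂)))) eq ⟨
    _ ∎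
    where open ≡-Reasoning
  rearrange : ∀ a b q₁ q₂ → b * (a * q₁) + a * (b * q₂) ≡ a * b * (q₁ + q₂)
  rearrange = solve-∀
  upper : s * (a * b * (Q₁ + Q₂) - (b * (P₁ * P₁) + a * (P₂ * P₂))) ≤ 0ℤ
  upper = begin
    s * (a * b * (Q₁ + Q₂) - (b * (P₁ * P₁) + a * (P₂ * P₂)))
      ≤⟨ *-monoˡ-≤-nonNeg s {{nonNegative (<⇒≤ 0<s)}} (i≤j⇒i-j≤0 (begin
           a * b * (Q₁ + Q₂)             ≡⟨ rearrange a b Q₁ Q₂ ⟨
           b * (a * Q₁) + a * (b * Q₂)   ≤⟨ +-mono-≤
             (*-monoˡ-≤-nonNeg b {{nonNegative (<⇒≤ 0<b)}} le₁)
             (*-monoˡ-≤-nonNeg a {{nonNegative (<⇒≤ 0<a)}} le₂) ⟩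
           b * (P₁ * P₁) + a * (P₂ * P₂) ∎)) ⟩
    s * 0ℤ ≡⟨ *-zeroʳ s ⟩
    0ℤ ∎
    where open ≤-Reasoning

-- Formal combinations and Gram forms

combine : ∀ {G : Set} → (G → ℤ) → List (ℤ × G) → ℤ
combine φ []            = 0ℤ
combine φ ((z , g) ∷ x) = z * φ g + combine φ x

module _ {G : Set} where

  combine-cong : ∀ {φ ψ : G → ℤ} → (∀ g → φ g ≡ ψ g) → ∀ x → combine φ x ≡ combine ψ x
  combine-cong eq []            = refl
  combine-cong eq ((z , g) ∷ x) = cong₂ (λ p q → z * p + q) (eq g) (combine-cong eq x)

  combine-linear : ∀ w (φ ψ : G → ℤ) x →
    combine (λ g → w * φ g + ψ g) x ≡ w * combine φ x + combine ψ x
  combine-linear w φ ψ [] = trans (sym (*-zeroʳ w)) (sym (+-identityʳ (w * 0ℤ)))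
  combine-linear w φ ψ ((z , g) ∷ x) =
    trans (cong (λ t → z * (w * φ g + ψ g) + t) (combine-linear w φ ψ x))
          (lemma z w (φ g) (ψ g) (combine φ x) (combine ψ x))
    where
    lemma : ∀ z w p q r t → z * (w * p + q) + (w * r + t) ≡ w * (z * p + r) + (z * q + t)
    lemma = solve-∀

  combine-0 : ∀ (x : List (ℤ × G)) → combine (λ _ → 0ℤ) x ≡ 0ℤ
  combine-0 []            = refl
  combine-0 ((z , g) ∷ x) = cong₂ _+_ (*-zeroʳ z) (combine-0 x)

  combine-++ : ∀ (φ : G → ℤ) x y → combine φ (x ++ y) ≡ combine φ x + combine φ y
  combine-++ φ []            y = sym (+-identityˡ _)
  combine-++ φ ((z , g) ∷ x) y =
    trans (cong (λ t → z * φ g + t) (combine-++ φ x y)) (sym (+-assoc (z * φ g) _ _))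

  combine-scale : ∀ (φ : G → ℤ) w x →
    combine φ (map (λ (z , g) → w * z , g) x) ≡ w * combine φ x
  combine-scale φ w []            = sym (*-zeroʳ w)
  combine-scale φ w ((z , g) ∷ x) =
    trans (cong (λ t → w * z * φ g + t) (combine-scale φ w x)) (lemma w z (φ g) (combine φ x))
    where
    lemma : ∀ w z p q → w * z * p + w * q ≡ w * (z * p + q)
    lemma = solve-∀

indicator : ∀ {P : Set} → Dec P → ℤ
indicator (yes _) = 1ℤ
indicator (no _)  = 0ℤ

indicator-yes : ∀ {P : Set} (d : Dec P) → P → indicator d ≡ 1ℤ
indicator-yes (yes _) p = refl
indicator-yes (no ¬p) p = contradiction p ¬p

indicator-no : ∀ {P : Set} (d : Dec P) → ¬ P → indicator d ≡ 0ℤ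
indicator-no (yes p) ¬p = contradiction p ¬p
indicator-no (no _)  ¬p = refl

indicator-⇔ : ∀ {P Q : Set} (d : Dec P) (e : Dec Q) → (P → Q) → (Q → P) → indicator d ≡ indicator e
indicator-⇔ (yes p) e f g = sym (indicator-yes e (f p))
indicator-⇔ (no ¬p) e f g = sym (indicator-no e (λ q → ¬p (g q)))

module _ {G : Set} (_~_ : G → G → Set) (_~?_ : ∀ g h → Dec (g ~ h))
         (~-sym : ∀ {g h} → g ~ h → h ~ g) (~-trans : ∀ {g h i} → g ~ h → h ~ i → g ~ i) where

  private
    classSum : List (ℤ × G) → G → ℤ
    classSum x k = combine (λ h → indicator (k ~? h)) x

    squares : List (ℤ × G) → List G → ℤ
    squares x []       = 0ℤ
    squares x (k ∷ ks) = classSum x k * classSum x k + squares x ks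

    gram : List (ℤ × G) → ℤ
    gram x = combine (classSum x) x

    classSum-resp : ∀ x {g k} → g ~ k → classSum x g ≡ classSum x k
    classSum-resp x g~k = combine-cong
      (λ h → indicator-⇔ (_ ~? h) (_ ~? h) (~-trans (~-sym g~k)) (~-trans g~k)) x

    gram-∷ : ∀ z g x → gram ((z , g) ∷ x)
      ≡ z * (z * indicator (g ~? g) + classSum x g) + (z * classSum x g + gram x)
    gram-∷ z g x = cong (λ t → z * (z * indicator (g ~? g) + classSum x g) + t) (begin
      combine (λ h → z * indicator (h ~? g) + classSum x h) x
        ≡⟨ combine-linear z (λ h → indicator (h ~? g)) (classSum x) x ⟩
      z * combine (λ h → indicator (h ~? g)) x + gram x
        ≡⟨ cong (λ t → z * t + gram x)
             (combine-cong (λ h → indicator-⇔ (h ~? g) (g ~? h) ~-sym ~-sym) x) ⟩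
      z * classSum x g + gram x ∎)
      where open ≡-Reasoning

    squares-fresh : ∀ z g x ks → All (λ k → ¬ (g ~ k)) ks → squares ((z , g) ∷ x) ks ≡ squares x ks
    squares-fresh z g x []       []        = refl
    squares-fresh z g x (k ∷ ks) (≁ ∷ ≁s) = cong₂ (λ p q → p * p + q) same (squares-fresh z g x ks ≁s)
      where
      same : z * indicator (k ~? g) + classSum x k ≡ classSum x k
      same = trans (cong (λ t → z * t + classSum x k) (indicator-no (k ~? g) (λ k~g → ≁ (~-sym k~g))))
        (trans (cong (λ t → t + classSum x k) (*-zeroʳ z)) (+-identityˡ _))

    squares-known : ∀ z g x ks → AllPairs (λ k l → ¬ (k ~ l)) ks → Any (g ~_) ks →
      squares ((z , g) ∷ x) ks ≡ squares x ks + (z * z + (z * classSum x g + z * classSum x g))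
    squares-known z g x (k ∷ ks) (≁s ∷ _) (here g~k) = begin
      (z * indicator (k ~? g) + classSum x k) * (z * indicator (k ~? g) + classSum x k)
        + squares ((z , g) ∷ x) ks
        ≡⟨ cong₂ (λ i q → (z * i + classSum x k) * (z * i + classSum x k) + q)
             (indicator-yes (k ~? g) (~-sym g~k))
             (squares-fresh z g x ks (All.map (λ k≁l g~l → k≁l (~-trans (~-sym g~k) g~l)) ≁s)) ⟩
      (z * 1ℤ + classSum x k) * (z * 1ℤ + classSum x k) + squares x ks
        ≡⟨ lemma z (classSum x k) (squares x ks) ⟩
      classSum x k * classSum x k + squares x ks + (z * z + (z * classSum x k + z * classSum x k))
        ≡⟨ cong (λ t → classSum x k * classSum x k + squares x ks + (z * z + (z * t + z * t)))
             (classSum-resp x g~k) ⟨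
      _ ∎
      where
      open ≡-Reasoning
      lemma : ∀ z s q → (z * 1ℤ + s) * (z * 1ℤ + s) + q ≡ s * s + q + (z * z + (z * s + z * s))
      lemma = solve-∀
    squares-known z g x (k ∷ ks) (≁s ∷ ≁ss) (there any) = begin
      (z * indicator (k ~? g) + classSum x k) * (z * indicator (k ~? g) + classSum x k)
        + squares ((z , g) ∷ x) ks
        ≡⟨ cong₂ (λ i q → (z * i + classSum x k) * (z * i + classSum x k) + q)
             (indicator-no (k ~? g) k≁g) (squares-known z g x ks ≁ss any) ⟩
      (z * 0ℤ + classSum x k) * (z * 0ℤ + classSum x k) + (squares x ks + _)
        ≡⟨ lemma z (classSum x k) (squares x ks) _ ⟩
      _ ∎
      where
      open ≡-Reasoning
      k≁g : ¬ (k ~ g)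
      k≁g k~g = All.lookupAny ≁s any .proj₁ (~-trans k~g (All.lookupAny ≁s any .proj₂))
      lemma : ∀ z s q r → (z * 0ℤ + s) * (z * 0ℤ + s) + (q + r) ≡ s * s + q + r
      lemma = solve-∀

    -- The Gram form of a partial equivalence is the sum of the squared class sums; `ks` represents
    -- some of the classes. Induction on the list, with head (z , g) and t the class sum of g in the
    -- tail: if g is not related to itself, it is related to nothing and contributes nothing; if its
    -- class is represented, both sides grow by z² + 2 z t; if it is a new class, the induction
    -- hypothesis is used for `g ∷ ks`, and the square (z + t)² is dropped.
    squares≤gram : ∀ x ks → AllPairs (λ k l → ¬ (k ~ l)) ks → All (λ k → k ~ k) ks →
      squares x ks ≤ gram x
    squares≤gram [] ks ≁ss ~s = ≤-reflexive (zero-squares ks)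
      where
      zero-squares : ∀ ks → squares [] ks ≡ 0ℤ
      zero-squares []       = refl
      zero-squares (k ∷ ks) = trans (+-identityˡ _) (zero-squares ks)
    squares≤gram ((z , g) ∷ x) ks ≁ss ~s = extend (g ~? g) (Any.any? (g ~?_) ks)
      where
      t = classSum x g
      increment : ∀ {i} → indicator (g ~? g) ≡ i →
        gram ((z , g) ∷ x) ≡ z * (z * i + t) + (z * t + gram x)
      increment eq = trans (gram-∷ z g x) (cong (λ i → z * (z * i + t) + (z * t + gram x)) eq)
      isolated : ∀ z q → z * (z * 0ℤ + 0ℤ) + (z * 0ℤ + q) ≡ q
      isolated = solve-∀
      reorder : ∀ z s q → z * (z * 1ℤ + s) + (z * s + q) ≡ q + (z * z + (z * s + z * s))
      reorder = solve-∀
      complete : ∀ z s q → (z + s) * (z + s) + q ≡ s * s + q + (z * z + (z * s + z * s))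
      complete = solve-∀
      extend : Dec (g ~ g) → Dec (Any (g ~_) ks) → squares ((z , g) ∷ x) ks ≤ gram ((z , g) ∷ x)
      extend (no ¬g~g) _ = begin
        squares ((z , g) ∷ x) ks
          ≡⟨ squares-fresh z g x ks (All.universal (λ k g~k → ¬g~g (~-trans g~k (~-sym g~k))) ks) ⟩
        squares x ks
          ≤⟨ squares≤gram x ks ≁ss ~s ⟩
        gram x
          ≡⟨ isolated z (gram x) ⟨
        z * (z * 0ℤ + 0ℤ) + (z * 0ℤ + gram x)
          ≡⟨ cong (λ r → z * (z * 0ℤ + r) + (z * r + gram x)) no-class ⟨
        z * (z * 0ℤ + t) + (z * t + gram x)
          ≡⟨ increment (indicator-no (g ~? g) ¬g~g) ⟨
        gram ((z , g) ∷ x) ∎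
        where
        open ≤-Reasoning
        no-class : t ≡ 0ℤ
        no-class = trans (combine-cong
          (λ h → indicator-no (g ~? h) (λ g~h → ¬g~g (~-trans g~h (~-sym g~h)))) x) (combine-0 x)
      extend (yes g~g) (yes any) = begin
        squares ((z , g) ∷ x) ks
          ≡⟨ squares-known z g x ks ≁ss any ⟩
        squares x ks + (z * z + (z * t + z * t))
          ≤⟨ +-monoˡ-≤ _ (squares≤gram x ks ≁ss ~s) ⟩
        gram x + (z * z + (z * t + z * t))
          ≡⟨ reorder z t (gram x) ⟨
        z * (z * 1ℤ + t) + (z * t + gram x)
          ≡⟨ increment (indicator-yes (g ~? g) g~g) ⟨
        gram ((z , g) ∷ x) ∎
        where open ≤-Reasoning
      extend (yes g~g) (no ¬any) = begin
        squares ((z , g) ∷ x) ks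
          ≡⟨ squares-fresh z g x ks fresh ⟩
        squares x ks
          ≡⟨ +-identityˡ _ ⟨
        0ℤ + squares x ks
          ≤⟨ +-monoˡ-≤ (squares x ks) (0≤i*i (z + t)) ⟩
        (z + t) * (z + t) + squares x ks
          ≡⟨ complete z t (squares x ks) ⟩
        (t * t + squares x ks) + (z * z + (z * t + z * t))
          ≤⟨ +-monoˡ-≤ _ (squares≤gram x (g ∷ ks) (fresh ∷ ≁ss) (g~g ∷ ~s)) ⟩
        gram x + (z * z + (z * t + z * t))
          ≡⟨ reorder z t (gram x) ⟨
        z * (z * 1ℤ + t) + (z * t + gram x)
          ≡⟨ increment (indicator-yes (g ~? g) g~g) ⟨
        gram ((z , g) ∷ x) ∎
        where
        open ≤-Reasoning
        fresh = ¬Any⇒All¬ ks ¬any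

  0≤gram : ∀ x → 0ℤ ≤ combine (λ g → combine (λ h → indicator (g ~? h)) x) x
  0≤gram x = squares≤gram x [] [] []

-- Deletion–contraction over the flats of a matroid

-- Flats of a matroid: a state is a flat, s ∙ f the flat spanned by s and f,
-- so that "Loop s f" says that f is a loop of the contraction by s.
record FlatSystem : Set₁ where
  infixl 7 _∙_
  infix 4 _≈_
  field
    State Element : Set
    _≈_       : State → State → Set
    _∙_       : State → Element → State
    Loop      : State → Element → Set
    loop?     : ∀ s f → Dec (Loop s f)
    ≈-sym     : ∀ {s t} → s ≈ t → t ≈ s
    ∙-cong    : ∀ {s t} f → s ≈ t → s ∙ f ≈ t ∙ f
    ∙-comm    : ∀ s f g → s ∙ f ∙ g ≈ s ∙ g ∙ f
    Loop-resp : ∀ {s t f} → s ≈ t → Loop s f → Loop t f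
    Loop-self : ∀ s f → Loop (s ∙ f) f
    Loop-mono : ∀ {s f} g → Loop s f → Loop (s ∙ g) f
    exchange  : ∀ {s f g} → ¬ Loop s g → Loop (s ∙ f) g → s ∙ f ≈ s ∙ g

module Calculus (M : FlatSystem) where
  open FlatSystem M public

  Fn : Set
  Fn = State → ℕ → ℤ

  Resp : Fn → Set
  Resp φ = ∀ {s t} → s ≈ t → ∀ k → φ s k ≡ φ t k

  -- Divisor classes, acting on families of intersection numbers: A and B are the two
  -- hyperplane classes, Z f is the locus where f vanishes, with self-intersection Z f (B − A).
  data Divisor : Set where
    A B : Divisor
    Z   : Element → Divisor

  -- Θ f is deletion–contraction; the deletion lowers the degree by one, and the value it
  -- would need in degree −1 is taken to be 0.
  private
    vanish : ∀ {s f} → Dec (Loop s f) → Fn → ℕ → ℤ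
    vanish {s}     (yes _) φ k = φ s (suc k) - φ s k
    vanish {s} {f} (no _)  φ k = φ (s ∙ f) (suc k)

    delcon : ∀ {s f} → Dec (Loop s f) → Fn → ℕ → ℤ
    delcon {s}     (yes _) φ k       = φ s k
    delcon {s} {f} (no _)  φ zero    = φ (s ∙ f) zero
    delcon {s} {f} (no _)  φ (suc k) = φ s k + φ (s ∙ f) (suc k)

  op : Divisor → Fn → Fn
  op A     φ s k = φ s k
  op B     φ s k = φ s (suc k)
  op (Z f) φ s k = vanish (loop? s f) φ k

  Θ : Element → Fn → Fn
  Θ f φ s k = delcon (loop? s f) φ k

  op-Z-loop : ∀ {s f} φ k → Loop s f → op (Z f) φ s k ≡ φ s (suc k) - φ s k
  op-Z-loop {s} {f} φ k l with loop? s f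
  ... | yes _ = refl
  ... | no ¬l = contradiction l ¬l

  op-Z-link : ∀ {s f} φ k → ¬ Loop s f → op (Z f) φ s k ≡ φ (s ∙ f) (suc k)
  op-Z-link {s} {f} φ k ¬l with loop? s f
  ... | yes l = contradiction l ¬l
  ... | no _  = refl

  Θ-loop : ∀ {s f} φ k → Loop s f → Θ f φ s k ≡ φ s k
  Θ-loop {s} {f} φ k l with loop? s f
  ... | yes _ = refl
  ... | no ¬l = contradiction l ¬l

  Θ-zero : ∀ {s f} φ → ¬ Loop s f → Θ f φ s zero ≡ φ (s ∙ f) zero
  Θ-zero {s} {f} φ ¬l with loop? s f
  ... | yes l = contradiction l ¬l
  ... | no _  = refl

  Θ-suc : ∀ {s f} φ k → ¬ Loop s f → Θ f φ s (suc k) ≡ φ s k + φ (s ∙ f) (suc k)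
  Θ-suc {s} {f} φ k ¬l with loop? s f
  ... | yes l = contradiction l ¬l
  ... | no _  = refl

  ¬Loop-resp : ∀ {s t f} → s ≈ t → ¬ Loop s f → ¬ Loop t f
  ¬Loop-resp eq ¬l l = ¬l (Loop-resp (≈-sym eq) l)

  parallel-sym : ∀ {s f g} → ¬ Loop s g → Loop (s ∙ f) g → Loop (s ∙ g) f
  parallel-sym {s} {f} ¬l p = Loop-resp (exchange ¬l p) (Loop-self s f)

  op-resp : ∀ g {φ} → Resp φ → Resp (op g φ)
  op-resp A r eq k = r eq k
  op-resp B r eq k = r eq (suc k)
  op-resp (Z f) {φ} r {s} {t} eq k = go (loop? s f)
    where
    go : Dec (Loop s f) → op (Z f) φ s k ≡ op (Z f) φ t k
    go (yes l) = trans (op-Z-loop φ k l)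
      (trans (cong₂ _-_ (r eq (suc k)) (r eq k)) (sym (op-Z-loop φ k (Loop-resp eq l))))
    go (no ¬l) = trans (op-Z-link φ k ¬l)
      (trans (r (∙-cong f eq) (suc k)) (sym (op-Z-link φ k (¬Loop-resp eq ¬l))))

  Θ-resp : ∀ f {φ} → Resp φ → Resp (Θ f φ)
  Θ-resp f {φ} r {s} {t} eq k = go k (loop? s f)
    where
    go : ∀ k → Dec (Loop s f) → Θ f φ s k ≡ Θ f φ t k
    go k (yes l) = trans (Θ-loop φ k l) (trans (r eq k) (sym (Θ-loop φ k (Loop-resp eq l))))
    go zero (no ¬l) = trans (Θ-zero φ ¬l)
      (trans (r (∙-cong f eq) zero) (sym (Θ-zero φ (¬Loop-resp eq ¬l))))
    go (suc k) (no ¬l) = trans (Θ-suc φ k ¬l)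
      (trans (cong₂ _+_ (r eq k) (r (∙-cong f eq) (suc k))) (sym (Θ-suc φ k (¬Loop-resp eq ¬l))))

  op-cong : ∀ g {φ ψ} → (∀ s k → φ s k ≡ ψ s k) → ∀ s k → op g φ s k ≡ op g ψ s k
  op-cong A     eq s k = eq s k
  op-cong B     eq s k = eq s (suc k)
  op-cong (Z f) eq s k with loop? s f
  ... | yes _ = cong₂ _-_ (eq s (suc k)) (eq s k)
  ... | no _  = eq (s ∙ f) (suc k)

  Θ-cong : ∀ f {φ ψ} → (∀ s k → φ s k ≡ ψ s k) → ∀ s k → Θ f φ s k ≡ Θ f ψ s k
  Θ-cong f eq s k with loop? s f
  Θ-cong f eq s k       | yes _ = eq s k
  Θ-cong f eq s zero    | no _  = eq (s ∙ f) zero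
  Θ-cong f eq s (suc k) | no _  = cong₂ _+_ (eq s k) (eq (s ∙ f) (suc k))

  op-linear : ∀ g w φ ψ s k →
    op g (λ s k → w * φ s k + ψ s k) s k ≡ w * op g φ s k + op g ψ s k
  op-linear A     w φ ψ s k = refl
  op-linear B     w φ ψ s k = refl
  op-linear (Z f) w φ ψ s k with loop? s f
  ... | yes _ = lemma w (φ s (suc k)) (φ s k) (ψ s (suc k)) (ψ s k)
    where
    lemma : ∀ w p q r t → w * p + r - (w * q + t) ≡ w * (p - q) + (r - t)
    lemma = solve-∀
  ... | no _  = refl

  Θ-linear : ∀ f w φ ψ s k →
    Θ f (λ s k → w * φ s k + ψ s k) s k ≡ w * Θ f φ s k + Θ f ψ s k
  Θ-linear f w φ ψ s k with loop? s f
  Θ-linear f w φ ψ s k       | yes _ = refl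
  Θ-linear f w φ ψ s zero    | no _  = refl
  Θ-linear f w φ ψ s (suc k) | no _  = lemma w (φ s k) (φ (s ∙ f) (suc k)) (ψ s k) (ψ (s ∙ f) (suc k))
    where
    lemma : ∀ w p q r t → w * p + r + (w * q + t) ≡ w * (p + q) + (r + t)
    lemma = solve-∀

  op-0 : ∀ g s k → op g (λ _ _ → 0ℤ) s k ≡ 0ℤ
  op-0 A     s k = refl
  op-0 B     s k = refl
  op-0 (Z f) s k with loop? s f
  ... | yes _ = refl
  ... | no _  = refl

  Θ-0 : ∀ f s k → Θ f (λ _ _ → 0ℤ) s k ≡ 0ℤ
  Θ-0 f s k with loop? s f
  Θ-0 f s k       | yes _ = refl
  Θ-0 f s zero    | no _  = refl
  Θ-0 f s (suc k) | no _  = refl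

  -- Makes the intersection form symmetric. For parallel non-loops f and g, each becomes a loop once
  -- the other is contracted, and by `exchange` both contractions reach the same flat.
  op-comm : ∀ g h {φ} → Resp φ → ∀ s k → op g (op h φ) s k ≡ op h (op g φ) s k
  op-comm A     h     r s k = refl
  op-comm B     A     r s k = refl
  op-comm B     B     r s k = refl
  op-comm B     (Z f) r s k with loop? s f
  ... | yes _ = refl
  ... | no _  = refl
  op-comm (Z f) A     r s k = refl
  op-comm (Z f) B     r s k with loop? s f
  ... | yes _ = refl
  ... | no _  = refl
  op-comm (Z f) (Z g) {φ} r s k = go (loop? s f) (loop? s g)
    where
    open ≡-Reasoning
    both : ∀ {f g} → Loop s f → Loop s g → op (Z f) (op (Z g) φ) s k
      ≡ φ s (suc (suc k)) - φ s (suc k) - (φ s (suc k) - φ s k)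
    both l m = trans (op-Z-loop _ k l) (cong₂ _-_ (op-Z-loop φ (suc k) m) (op-Z-loop φ k m))
    mixed : ∀ {f g} → Loop s f → ¬ Loop s g → op (Z f) (op (Z g) φ) s k ≡ op (Z g) (op (Z f) φ) s k
    mixed {f} {g} l ¬m = begin
      op (Z f) (op (Z g) φ) s k                     ≡⟨ op-Z-loop _ k l ⟩
      op (Z g) φ s (suc k) - op (Z g) φ s k
        ≡⟨ cong₂ _-_ (op-Z-link φ (suc k) ¬m) (op-Z-link φ k ¬m) ⟩
      φ (s ∙ g) (suc (suc k)) - φ (s ∙ g) (suc k)   ≡⟨ op-Z-loop φ (suc k) (Loop-mono g l) ⟨
      op (Z f) φ (s ∙ g) (suc k)                    ≡⟨ op-Z-link _ k ¬m ⟨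
      op (Z g) (op (Z f) φ) s k                     ∎
    skew : ¬ Loop s f → ¬ Loop s g → Dec (Loop (s ∙ f) g) →
      op (Z f) (op (Z g) φ) s k ≡ op (Z g) (op (Z f) φ) s k
    skew ¬l ¬m (yes p) = begin
      op (Z f) (op (Z g) φ) s k                     ≡⟨ op-Z-link _ k ¬l ⟩
      op (Z g) φ (s ∙ f) (suc k)                    ≡⟨ op-Z-loop φ (suc k) p ⟩
      φ (s ∙ f) (suc (suc k)) - φ (s ∙ f) (suc k)
        ≡⟨ cong₂ _-_ (r (exchange ¬m p) (suc (suc k))) (r (exchange ¬m p) (suc k)) ⟩
      φ (s ∙ g) (suc (suc k)) - φ (s ∙ g) (suc k)   ≡⟨ op-Z-loop φ (suc k) (parallel-sym ¬m p) ⟨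
      op (Z f) φ (s ∙ g) (suc k)                    ≡⟨ op-Z-link _ k ¬m ⟨
      op (Z g) (op (Z f) φ) s k                     ∎
    skew ¬l ¬m (no ¬p) = begin
      op (Z f) (op (Z g) φ) s k                     ≡⟨ op-Z-link _ k ¬l ⟩
      op (Z g) φ (s ∙ f) (suc k)                    ≡⟨ op-Z-link φ (suc k) ¬p ⟩
      φ (s ∙ f ∙ g) (suc (suc k))                   ≡⟨ r (∙-comm s f g) (suc (suc k)) ⟩
      φ (s ∙ g ∙ f) (suc (suc k))
        ≡⟨ op-Z-link φ (suc k) (λ q → ¬p (parallel-sym ¬l q)) ⟨
      op (Z f) φ (s ∙ g) (suc k)                    ≡⟨ op-Z-link _ k ¬m ⟨
      op (Z g) (op (Z f) φ) s k                     ∎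
    go : Dec (Loop s f) → Dec (Loop s g) → op (Z f) (op (Z g) φ) s k ≡ op (Z g) (op (Z f) φ) s k
    go (yes l) (yes m) = trans (both l m) (sym (both m l))
    go (yes l) (no ¬m) = mixed l ¬m
    go (no ¬l) (yes m) = sym (mixed m ¬l)
    go (no ¬l) (no ¬m) = skew ¬l ¬m (loop? (s ∙ f) g)

  -- The critical case is that of parallel non-loops h and f. After contraction of h the element f
  -- is a loop and `Θ f` changes nothing, so φ (s ∙ h) (k + 2) has to come back from the deletion
  -- term φ (s ∙ h) (k + 1) and from `Z h` at s ∙ f, where h is a loop: the value B - A there makes
  -- the sum telescope. The hypothesis on φ s 0 is due to the deletion term set to 0 in degree -1,
  -- since a shift by B turns that term into φ s 0.
  op-Θ-comm : ∀ g f {φ} → Resp φ → (∀ s → φ s 0 ≡ 0ℤ) →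
    ∀ s k → op g (Θ f φ) s k ≡ Θ f (op g φ) s k
  op-Θ-comm A f r φ0 s k = refl
  op-Θ-comm B f {φ} r φ0 s k = go k (loop? s f)
    where
    go : ∀ k → Dec (Loop s f) → Θ f φ s (suc k) ≡ Θ f (op B φ) s k
    go k       (yes l) = trans (Θ-loop φ (suc k) l) (sym (Θ-loop (op B φ) k l))
    go zero    (no ¬l) = trans (Θ-suc φ 0 ¬l)
      (trans (cong (λ t → t + φ (s ∙ f) 1) (φ0 s)) (trans (+-identityˡ _) (sym (Θ-zero (op B φ) ¬l))))
    go (suc k) (no ¬l) = trans (Θ-suc φ (suc k) ¬l) (sym (Θ-suc (op B φ) k ¬l))
  op-Θ-comm (Z h) f {φ} r φ0 s = go (loop? s f) (loop? s h)
    where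
    open ≡-Reasoning
    parallel : ¬ Loop s f → ¬ Loop s h → Dec (Loop (s ∙ h) f) →
      ∀ k → op (Z h) (Θ f φ) s k ≡ Θ f (op (Z h) φ) s k
    parallel ¬l ¬m (yes p) zero = begin
      op (Z h) (Θ f φ) s 0              ≡⟨ op-Z-link _ 0 ¬m ⟩
      Θ f φ (s ∙ h) 1                   ≡⟨ Θ-loop φ 1 p ⟩
      φ (s ∙ h) 1                       ≡⟨ r (exchange ¬l p) 1 ⟩
      φ (s ∙ f) 1                       ≡⟨ +-identityʳ _ ⟨
      φ (s ∙ f) 1 - 0ℤ                  ≡⟨ cong (λ t → φ (s ∙ f) 1 - t) (φ0 (s ∙ f)) ⟨
      φ (s ∙ f) 1 - φ (s ∙ f) 0         ≡⟨ op-Z-loop φ 0 (parallel-sym ¬l p) ⟨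
      op (Z h) φ (s ∙ f) 0              ≡⟨ Θ-zero _ ¬l ⟨
      Θ f (op (Z h) φ) s 0              ∎
    parallel ¬l ¬m (yes p) (suc k) = begin
      op (Z h) (Θ f φ) s (suc k)        ≡⟨ op-Z-link _ (suc k) ¬m ⟩
      Θ f φ (s ∙ h) (suc (suc k))       ≡⟨ Θ-loop φ (suc (suc k)) p ⟩
      φ (s ∙ h) (suc (suc k))           ≡⟨ telescope (φ (s ∙ h) (suc k)) _ ⟩
      φ (s ∙ h) (suc k) + (φ (s ∙ h) (suc (suc k)) - φ (s ∙ h) (suc k))
        ≡⟨ cong₂ (λ p q → φ (s ∙ h) (suc k) + (p - q))
             (r (exchange ¬l p) (suc (suc k))) (r (exchange ¬l p) (suc k)) ⟩
      φ (s ∙ h) (suc k) + (φ (s ∙ f) (suc (suc k)) - φ (s ∙ f) (suc k))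
        ≡⟨ cong₂ _+_ (op-Z-link φ k ¬m) (op-Z-loop φ (suc k) (parallel-sym ¬l p)) ⟨
      op (Z h) φ s k + op (Z h) φ (s ∙ f) (suc k)
        ≡⟨ Θ-suc _ k ¬l ⟨
      Θ f (op (Z h) φ) s (suc k)        ∎
      where
      telescope : ∀ p q → q ≡ p + (q - p)
      telescope = solve-∀
    parallel ¬l ¬m (no ¬p) zero = begin
      op (Z h) (Θ f φ) s 0              ≡⟨ op-Z-link _ 0 ¬m ⟩
      Θ f φ (s ∙ h) 1                   ≡⟨ Θ-suc φ 0 ¬p ⟩
      φ (s ∙ h) 0 + φ (s ∙ h ∙ f) 1     ≡⟨ cong (λ t → t + φ (s ∙ h ∙ f) 1) (φ0 (s ∙ h)) ⟩
      0ℤ + φ (s ∙ h ∙ f) 1              ≡⟨ +-identityˡ _ ⟩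
      φ (s ∙ h ∙ f) 1                   ≡⟨ r (∙-comm s h f) 1 ⟩
      φ (s ∙ f ∙ h) 1                   ≡⟨ op-Z-link φ 0 (λ q → ¬p (parallel-sym ¬m q)) ⟨
      op (Z h) φ (s ∙ f) 0              ≡⟨ Θ-zero _ ¬l ⟨
      Θ f (op (Z h) φ) s 0              ∎
    parallel ¬l ¬m (no ¬p) (suc k) = begin
      op (Z h) (Θ f φ) s (suc k)        ≡⟨ op-Z-link _ (suc k) ¬m ⟩
      Θ f φ (s ∙ h) (suc (suc k))       ≡⟨ Θ-suc φ (suc k) ¬p ⟩
      φ (s ∙ h) (suc k) + φ (s ∙ h ∙ f) (suc (suc k))
        ≡⟨ cong₂ _+_ (sym (op-Z-link φ k ¬m)) (trans (r (∙-comm s h f) (suc (suc k)))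
             (sym (op-Z-link φ (suc k) (λ q → ¬p (parallel-sym ¬m q))))) ⟩
      op (Z h) φ s k + op (Z h) φ (s ∙ f) (suc k)
        ≡⟨ Θ-suc _ k ¬l ⟨
      Θ f (op (Z h) φ) s (suc k)        ∎
    go : Dec (Loop s f) → Dec (Loop s h) → ∀ k → op (Z h) (Θ f φ) s k ≡ Θ f (op (Z h) φ) s k
    go (yes l) (yes m) k = begin
      op (Z h) (Θ f φ) s k              ≡⟨ op-Z-loop _ k m ⟩
      Θ f φ s (suc k) - Θ f φ s k       ≡⟨ cong₂ _-_ (Θ-loop φ (suc k) l) (Θ-loop φ k l) ⟩
      φ s (suc k) - φ s k               ≡⟨ op-Z-loop φ k m ⟨
      op (Z h) φ s k                    ≡⟨ Θ-loop _ k l ⟨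
      Θ f (op (Z h) φ) s k              ∎
    go (yes l) (no ¬m) k = begin
      op (Z h) (Θ f φ) s k              ≡⟨ op-Z-link _ k ¬m ⟩
      Θ f φ (s ∙ h) (suc k)             ≡⟨ Θ-loop φ (suc k) (Loop-mono h l) ⟩
      φ (s ∙ h) (suc k)                 ≡⟨ op-Z-link φ k ¬m ⟨
      op (Z h) φ s k                    ≡⟨ Θ-loop _ k l ⟨
      Θ f (op (Z h) φ) s k              ∎
    go (no ¬l) (yes m) zero = begin
      op (Z h) (Θ f φ) s 0              ≡⟨ op-Z-loop _ 0 m ⟩
      Θ f φ s 1 - Θ f φ s 0             ≡⟨ cong₂ _-_ (Θ-suc φ 0 ¬l) (Θ-zero φ ¬l) ⟩
      φ s 0 + φ (s ∙ f) 1 - φ (s ∙ f) 0 ≡⟨ cong (λ t → t + φ (s ∙ f) 1 - φ (s ∙ f) 0) (φ0 s) ⟩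
      0ℤ + φ (s ∙ f) 1 - φ (s ∙ f) 0    ≡⟨ cong (λ t → t - φ (s ∙ f) 0) (+-identityˡ (φ (s ∙ f) 1)) ⟩
      φ (s ∙ f) 1 - φ (s ∙ f) 0         ≡⟨ op-Z-loop φ 0 (Loop-mono f m) ⟨
      op (Z h) φ (s ∙ f) 0              ≡⟨ Θ-zero _ ¬l ⟨
      Θ f (op (Z h) φ) s 0              ∎
    go (no ¬l) (yes m) (suc k) = begin
      op (Z h) (Θ f φ) s (suc k)        ≡⟨ op-Z-loop _ (suc k) m ⟩
      Θ f φ s (suc (suc k)) - Θ f φ s (suc k)
        ≡⟨ cong₂ _-_ (Θ-suc φ (suc k) ¬l) (Θ-suc φ k ¬l) ⟩
      φ s (suc k) + φ (s ∙ f) (suc (suc k)) - (φ s k + φ (s ∙ f) (suc k))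
        ≡⟨ lemma (φ s (suc k)) (φ (s ∙ f) (suc (suc k))) (φ s k) (φ (s ∙ f) (suc k)) ⟩
      φ s (suc k) - φ s k + (φ (s ∙ f) (suc (suc k)) - φ (s ∙ f) (suc k))
        ≡⟨ cong₂ _+_ (op-Z-loop φ k m) (op-Z-loop φ (suc k) (Loop-mono f m)) ⟨
      op (Z h) φ s k + op (Z h) φ (s ∙ f) (suc k)
        ≡⟨ Θ-suc _ k ¬l ⟨
      Θ f (op (Z h) φ) s (suc k)        ∎
      where
      lemma : ∀ p q r t → p + q - (r + t) ≡ p - r + (q - t)
      lemma = solve-∀
    go (no ¬l) (no ¬m) k = parallel ¬l ¬m (loop? (s ∙ h) f) k

  Θ-parallel : ∀ {s f g φ} → Resp φ → ¬ Loop s f → ¬ Loop s g → s ∙ f ≈ s ∙ g →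
    ∀ k → Θ f φ s k ≡ Θ g φ s k
  Θ-parallel {φ = φ} r ¬l ¬m eq zero    = trans (Θ-zero φ ¬l) (trans (r eq 0) (sym (Θ-zero φ ¬m)))
  Θ-parallel {s} {φ = φ} r ¬l ¬m eq (suc k) = trans (Θ-suc φ k ¬l)
    (trans (cong (λ t → φ s k + t) (r eq (suc k))) (sym (Θ-suc φ k ¬m)))

  Θ-comm : ∀ f g {φ} → Resp φ → ∀ s k → Θ f (Θ g φ) s k ≡ Θ g (Θ f φ) s k
  Θ-comm f g {φ} r s = λ k → go k (loop? s f) (loop? s g)
    where
    open ≡-Reasoning
    mixed : ∀ {f g} → Loop s f → ¬ Loop s g → ∀ k → Θ f (Θ g φ) s k ≡ Θ g (Θ f φ) s k
    mixed {f} {g} l ¬m zero = begin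
      Θ f (Θ g φ) s 0      ≡⟨ Θ-loop _ 0 l ⟩
      Θ g φ s 0            ≡⟨ Θ-zero φ ¬m ⟩
      φ (s ∙ g) 0          ≡⟨ Θ-loop φ 0 (Loop-mono g l) ⟨
      Θ f φ (s ∙ g) 0      ≡⟨ Θ-zero _ ¬m ⟨
      Θ g (Θ f φ) s 0      ∎
    mixed {f} {g} l ¬m (suc k) = begin
      Θ f (Θ g φ) s (suc k)           ≡⟨ Θ-loop _ (suc k) l ⟩
      Θ g φ s (suc k)                 ≡⟨ Θ-suc φ k ¬m ⟩
      φ s k + φ (s ∙ g) (suc k)       ≡⟨ cong₂ _+_ (Θ-loop φ k l) (Θ-loop φ (suc k) (Loop-mono g l)) ⟨
      Θ f φ s k + Θ f φ (s ∙ g) (suc k) ≡⟨ Θ-suc _ k ¬m ⟨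
      Θ g (Θ f φ) s (suc k)           ∎
    skew : ¬ Loop s f → ¬ Loop s g → Dec (Loop (s ∙ f) g) → ∀ k →
      Θ f (Θ g φ) s k ≡ Θ g (Θ f φ) s k
    skew ¬l ¬m (yes p) zero = begin
      Θ f (Θ g φ) s 0      ≡⟨ Θ-zero _ ¬l ⟩
      Θ g φ (s ∙ f) 0      ≡⟨ Θ-loop φ 0 p ⟩
      φ (s ∙ f) 0          ≡⟨ r (exchange ¬m p) 0 ⟩
      φ (s ∙ g) 0          ≡⟨ Θ-loop φ 0 (parallel-sym ¬m p) ⟨
      Θ f φ (s ∙ g) 0      ≡⟨ Θ-zero _ ¬m ⟨
      Θ g (Θ f φ) s 0      ∎
    skew ¬l ¬m (yes p) (suc k) = begin
      Θ f (Θ g φ) s (suc k)             ≡⟨ Θ-suc _ k ¬l ⟩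
      Θ g φ s k + Θ g φ (s ∙ f) (suc k) ≡⟨ cong₂ _+_ (sym (Θ-parallel r ¬l ¬m (exchange ¬m p) k))
        (trans (Θ-loop φ (suc k) p) (trans (r (exchange ¬m p) (suc k))
          (sym (Θ-loop φ (suc k) (parallel-sym ¬m p))))) ⟩
      Θ f φ s k + Θ f φ (s ∙ g) (suc k) ≡⟨ Θ-suc _ k ¬m ⟨
      Θ g (Θ f φ) s (suc k)             ∎
    skew ¬l ¬m (no ¬p) zero = begin
      Θ f (Θ g φ) s 0      ≡⟨ Θ-zero _ ¬l ⟩
      Θ g φ (s ∙ f) 0      ≡⟨ Θ-zero φ ¬p ⟩
      φ (s ∙ f ∙ g) 0      ≡⟨ r (∙-comm s f g) 0 ⟩
      φ (s ∙ g ∙ f) 0      ≡⟨ Θ-zero φ (λ q → ¬p (parallel-sym ¬l q)) ⟨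
      Θ f φ (s ∙ g) 0      ≡⟨ Θ-zero _ ¬m ⟨
      Θ g (Θ f φ) s 0      ∎
    skew ¬l ¬m (no ¬p) (suc k) = begin
      Θ f (Θ g φ) s (suc k)
        ≡⟨ Θ-suc _ k ¬l ⟩
      Θ g φ s k + Θ g φ (s ∙ f) (suc k)
        ≡⟨ cong (λ t → Θ g φ s k + t) (Θ-suc φ k ¬p) ⟩
      Θ g φ s k + (φ (s ∙ f) k + φ (s ∙ f ∙ g) (suc k))
        ≡⟨ swap k (φ (s ∙ f ∙ g) (suc k)) ⟩
      Θ f φ s k + (φ (s ∙ g) k + φ (s ∙ f ∙ g) (suc k))
        ≡⟨ cong (λ t → Θ f φ s k + (φ (s ∙ g) k + t)) (r (∙-comm s f g) (suc k)) ⟩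
      Θ f φ s k + (φ (s ∙ g) k + φ (s ∙ g ∙ f) (suc k))
        ≡⟨ cong (λ t → Θ f φ s k + t) (Θ-suc φ k (λ q → ¬p (parallel-sym ¬l q))) ⟨
      Θ f φ s k + Θ f φ (s ∙ g) (suc k)
        ≡⟨ Θ-suc _ k ¬m ⟨
      Θ g (Θ f φ) s (suc k) ∎
      where
      exch₀ : ∀ p q t → p + (q + t) ≡ q + (p + t)
      exch₀ = solve-∀
      exch₁ : ∀ o p q t → o + p + (q + t) ≡ o + q + (p + t)
      exch₁ = solve-∀
      swap : ∀ k t → Θ g φ s k + (φ (s ∙ f) k + t) ≡ Θ f φ s k + (φ (s ∙ g) k + t)
      swap zero t = begin
        Θ g φ s 0 + (φ (s ∙ f) 0 + t)   ≡⟨ cong (λ z → z + (φ (s ∙ f) 0 + t)) (Θ-zero φ ¬m) ⟩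
        φ (s ∙ g) 0 + (φ (s ∙ f) 0 + t) ≡⟨ exch₀ (φ (s ∙ g) 0) (φ (s ∙ f) 0) t ⟩
        φ (s ∙ f) 0 + (φ (s ∙ g) 0 + t) ≡⟨ cong (λ z → z + (φ (s ∙ g) 0 + t)) (Θ-zero φ ¬l) ⟨
        Θ f φ s 0 + (φ (s ∙ g) 0 + t)   ∎
      swap (suc j) t = begin
        Θ g φ s (suc j) + (φ (s ∙ f) (suc j) + t)
          ≡⟨ cong (λ z → z + (φ (s ∙ f) (suc j) + t)) (Θ-suc φ j ¬m) ⟩
        φ s j + φ (s ∙ g) (suc j) + (φ (s ∙ f) (suc j) + t)
          ≡⟨ exch₁ (φ s j) (φ (s ∙ g) (suc j)) (φ (s ∙ f) (suc j)) t ⟩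
        φ s j + φ (s ∙ f) (suc j) + (φ (s ∙ g) (suc j) + t)
          ≡⟨ cong (λ z → z + (φ (s ∙ g) (suc j) + t)) (Θ-suc φ j ¬l) ⟨
        Θ f φ s (suc j) + (φ (s ∙ g) (suc j) + t) ∎
    go : ∀ k → Dec (Loop s f) → Dec (Loop s g) → Θ f (Θ g φ) s k ≡ Θ g (Θ f φ) s k
    go k (yes l) (yes m) = begin
      Θ f (Θ g φ) s k      ≡⟨ Θ-loop _ k l ⟩
      Θ g φ s k            ≡⟨ Θ-loop φ k m ⟩
      φ s k                ≡⟨ Θ-loop φ k l ⟨
      Θ f φ s k            ≡⟨ Θ-loop _ k m ⟨
      Θ g (Θ f φ) s k      ∎
    go k (yes l) (no ¬m) = mixed l ¬m k
    go k (no ¬l) (yes m) = sym (mixed m ¬l k)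
    go k (no ¬l) (no ¬m) = skew ¬l ¬m (loop? (s ∙ f) g) k

  count : Fn → List Element → Fn
  count u []      = u
  count u (f ∷ E) = Θ f (count u E)

  count-resp : ∀ {u} E → Resp u → Resp (count u E)
  count-resp []      r = r
  count-resp (f ∷ E) r = Θ-resp f (count-resp E r)

  -- Reconciles two orders: `count` treats the edges as listed, while parking functions call for an
  -- edge at the current root block, wherever it stands.
  count-shift : ∀ {u} E f E′ → Resp u → ∀ s k →
    count u (E ++ f ∷ E′) s k ≡ Θ f (count u (E ++ E′)) s k
  count-shift []      f E′ r s k = refl
  count-shift (g ∷ E) f E′ r s k =
    trans (Θ-cong g (count-shift E f E′ r) s k) (Θ-comm g f (count-resp (E ++ E′) r) s k)

  count-loops : ∀ {u s} E → All (Loop s) E → ∀ k → count u E s k ≡ u s k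
  count-loops []      []       k = refl
  count-loops (f ∷ E) (l ∷ ls) k = trans (Θ-loop _ k l) (count-loops E ls k)

  count-0 : ∀ {u} E k → (∀ s → u s 0 ≡ 0ℤ) → (∀ s → u s k ≡ 0ℤ) → k ℕ.≤ 1 → ∀ s → count u E s k ≡ 0ℤ
  count-0 []      k u0 uk k≤1 s = uk s
  count-0 {u} (f ∷ E) k u0 uk k≤1 s = go k uk k≤1 (loop? s f)
    where
    go : ∀ k → (∀ s → u s k ≡ 0ℤ) → k ℕ.≤ 1 → Dec (Loop s f) → count u (f ∷ E) s k ≡ 0ℤ
    go k    uk k≤1 (yes l) = trans (Θ-loop _ k l) (count-0 E k u0 uk k≤1 s)
    go zero uk k≤1 (no ¬l) = trans (Θ-zero _ ¬l) (count-0 E 0 u0 uk k≤1 (s ∙ f))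
    go (suc zero) uk k≤1 (no ¬l) = trans (Θ-suc _ 0 ¬l)
      (cong₂ _+_ (count-0 E 0 u0 u0 ℕ.z≤n s) (count-0 E 1 u0 uk k≤1 (s ∙ f)))
    go (suc (suc k)) uk (ℕ.s≤s ()) (no ¬l)

  -- Supplies the strictness that `glue` asks for. At index 2 the deletion term sits at index 1 and
  -- vanishes, so there positivity comes from the contraction alone.
  count-pos : ∀ {u} E → (∀ s → u s 0 ≡ 0ℤ) → (∀ s → u s 1 ≡ 0ℤ) → (∀ s k → 0ℤ < u s (2 ℕ.+ k)) →
    ∀ s k → 0ℤ < count u E s (2 ℕ.+ k)
  count-pos []      u0 u1 pos s k = pos s k
  count-pos {u} (f ∷ E) u0 u1 pos s k = go k (loop? s f)
    where
    go : ∀ k → Dec (Loop s f) → 0ℤ < count u (f ∷ E) s (2 ℕ.+ k)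
    go k (yes l) = subst (0ℤ <_) (sym (Θ-loop _ (2 ℕ.+ k) l)) (count-pos E u0 u1 pos s k)
    go zero (no ¬l) = subst (0ℤ <_)
      (sym (trans (Θ-suc _ 1 ¬l) (trans
        (cong (λ t → t + count u E (s ∙ f) 2) (count-0 E 1 u0 u1 ℕ.≤-refl s)) (+-identityˡ _))))
      (count-pos E u0 u1 pos (s ∙ f) 0)
    go (suc k) (no ¬l) = subst (0ℤ <_) (sym (Θ-suc _ (2 ℕ.+ k) ¬l))
      (+-mono-< (count-pos E u0 u1 pos s k) (count-pos E u0 u1 pos (s ∙ f) (suc k)))

-- Intersection forms

module Lorentz (M : FlatSystem) where
  open Calculus M

  ⟦_⟧ : List (ℤ × Divisor) → Fn → Fn
  ⟦ x ⟧ φ s k = combine (λ g → op g φ s k) x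

  ⟦⟧-resp : ∀ x {φ} → Resp φ → Resp (⟦ x ⟧ φ)
  ⟦⟧-resp x r eq k = combine-cong (λ g → op-resp g r eq k) x

  ⟦⟧-cong : ∀ x {φ ψ} → (∀ s k → φ s k ≡ ψ s k) → ∀ s k → ⟦ x ⟧ φ s k ≡ ⟦ x ⟧ ψ s k
  ⟦⟧-cong x eq s k = combine-cong (λ g → op-cong g eq s k) x

  ⟦⟧-linear : ∀ x w φ ψ s k →
    ⟦ x ⟧ (λ s k → w * φ s k + ψ s k) s k ≡ w * ⟦ x ⟧ φ s k + ⟦ x ⟧ ψ s k
  ⟦⟧-linear x w φ ψ s k = trans (combine-cong (λ g → op-linear g w φ ψ s k) x)
    (combine-linear w (λ g → op g φ s k) (λ g → op g ψ s k) x)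

  ⟦⟧-0 : ∀ x s k → ⟦ x ⟧ (λ _ _ → 0ℤ) s k ≡ 0ℤ
  ⟦⟧-0 x s k = trans (combine-cong (λ g → op-0 g s k) x) (combine-0 x)

  op-⟦⟧ : ∀ g x {φ} → Resp φ → ∀ s k → op g (⟦ x ⟧ φ) s k ≡ ⟦ x ⟧ (op g φ) s k
  op-⟦⟧ g []            r s k = op-0 g s k
  op-⟦⟧ g ((z , h) ∷ x) {φ} r s k = trans (op-linear g z (op h φ) (⟦ x ⟧ φ) s k)
    (cong₂ (λ p q → z * p + q) (op-comm g h r s k) (op-⟦⟧ g x r s k))

  ⟦⟧-comm : ∀ x y {φ} → Resp φ → ∀ s k → ⟦ x ⟧ (⟦ y ⟧ φ) s k ≡ ⟦ y ⟧ (⟦ x ⟧ φ) s k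
  ⟦⟧-comm []            y r s k = sym (⟦⟧-0 y s k)
  ⟦⟧-comm ((z , g) ∷ x) y {φ} r s k =
    trans (cong₂ (λ p q → z * p + q) (op-⟦⟧ g y r s k) (⟦⟧-comm x y r s k))
          (sym (⟦⟧-linear y z (op g φ) (⟦ x ⟧ φ) s k))

  ⟦⟧-Θ : ∀ x f {φ} → Resp φ → (∀ s → φ s 0 ≡ 0ℤ) → ∀ s k → ⟦ x ⟧ (Θ f φ) s k ≡ Θ f (⟦ x ⟧ φ) s k
  ⟦⟧-Θ []            f r φ0 s k = sym (Θ-0 f s k)
  ⟦⟧-Θ ((z , g) ∷ x) f {φ} r φ0 s k =
    trans (cong₂ (λ p q → z * p + q) (op-Θ-comm g f r φ0 s k) (⟦⟧-Θ x f r φ0 s k))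
          (sym (Θ-linear f z (op g φ) (⟦ x ⟧ φ) s k))

  -- Prepares the second application of a class: commuting it with `Θ` requires `⟦ x ⟧ φ` to vanish
  -- at index 0 again, which takes two vanishing entries of φ.
  ⟦⟧-zero : ∀ x {φ} → (∀ s → φ s 0 ≡ 0ℤ) → (∀ s → φ s 1 ≡ 0ℤ) → ∀ s → ⟦ x ⟧ φ s 0 ≡ 0ℤ
  ⟦⟧-zero x {φ} φ0 φ1 s = trans (combine-cong op-zero x) (combine-0 x)
    where
    op-zero : ∀ g → op g φ s 0 ≡ 0ℤ
    op-zero A     = φ0 s
    op-zero B     = φ1 s
    op-zero (Z f) with loop? s f
    ... | yes l = cong₂ _-_ (φ1 s) (φ0 s)
    ... | no ¬l = φ1 (s ∙ f)

  ⟦⟧²-Θ : ∀ x f {φ} → Resp φ → (∀ s → φ s 0 ≡ 0ℤ) → (∀ s → φ s 1 ≡ 0ℤ) →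
    ∀ s k → ⟦ x ⟧ (⟦ x ⟧ (Θ f φ)) s k ≡ Θ f (⟦ x ⟧ (⟦ x ⟧ φ)) s k
  ⟦⟧²-Θ x f r φ0 φ1 s k = trans (⟦⟧-cong x (⟦⟧-Θ x f r φ0) s k)
    (⟦⟧-Θ x f (⟦⟧-resp x r) (⟦⟧-zero x φ0 φ1) s k)

  -- The Hodge index inequality Q(B,B) Q(x,x) ≤ Q(B,x)² for the intersection form
  -- Q(x,y) = ⟦ x ⟧ (⟦ y ⟧ d) s k.
  HodgeIndex : Fn → ℕ → Set
  HodgeIndex d k = ∀ s x →
    d s (2 ℕ.+ k) * ⟦ x ⟧ (⟦ x ⟧ d) s k ≤ ⟦ x ⟧ d s (1 ℕ.+ k) * ⟦ x ⟧ d s (1 ℕ.+ k)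

  private
    -- The form of Θ f d at s is Q₁ + Q₂ with Q₁ that of d at (s , k) and Q₂ that of d at
    -- (s ∙ f , 1 + k).  For p = B − Z f and q = Z f one has Q₁(q,x) = Q₂(p,x), so that
    -- (Q₁ + Q₂)(p,x) = Q₁(B,x) and (Q₁ + Q₂)(q,x) = Q₂(B,x).
    -- Both inequalities are applied to y = μ x + D (b p − a q).
    hodge-link : ∀ {d} s f k → Resp d → ¬ Loop s f →
      0ℤ < d s (2 ℕ.+ k) → 0ℤ < d (s ∙ f) (3 ℕ.+ k) → 0ℤ < d (s ∙ f) (2 ℕ.+ k) →
      HodgeIndex d k → HodgeIndex d (suc k) → ∀ x →
      (d s (2 ℕ.+ k) + d (s ∙ f) (3 ℕ.+ k)) * (⟦ x ⟧ (⟦ x ⟧ d) s k + ⟦ x ⟧ (⟦ x ⟧ d) (s ∙ f) (suc k))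
      ≤ (⟦ x ⟧ d s (1 ℕ.+ k) + ⟦ x ⟧ d (s ∙ f) (2 ℕ.+ k)) * (⟦ x ⟧ d s (1 ℕ.+ k) + ⟦ x ⟧ d (s ∙ f) (2 ℕ.+ k))
    hodge-link {d} s f k r ¬l 0<a 0<b 0<c hodge₁ hodge₂ x =
      glue u v (α₁ + α₂) (⟦ y ⟧ (⟦ y ⟧ d) s k) (⟦ y ⟧ (⟦ y ⟧ d) (s ∙ f) (suc k)) 0<a 0<b 0<c
        (subst (λ t → a * ⟦ y ⟧ (⟦ y ⟧ d) s k ≤ t * t)
          (trans Y₁ (B-value₁ a b c u μ D)) (hodge₁ s y))
        (subst (λ t → b * ⟦ y ⟧ (⟦ y ⟧ d) (s ∙ f) (suc k) ≤ t * t)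
          (trans Y₂ (B-value₂ a b c v μ D)) (hodge₂ (s ∙ f) y))
        (trans (cong₂ _+_ Q₁ Q₂) (total a b c g u v w α₁ α₂ μ D))
      where
      open ≡-Reasoning
      a b c g u v w α₁ α₂ D μ β γ : ℤ
      a  = d s (2 ℕ.+ k)
      b  = d (s ∙ f) (3 ℕ.+ k)
      c  = d (s ∙ f) (2 ℕ.+ k)
      g  = d (s ∙ f) (1 ℕ.+ k)
      u  = ⟦ x ⟧ d s (1 ℕ.+ k)
      v  = ⟦ x ⟧ d (s ∙ f) (2 ℕ.+ k)
      w  = ⟦ x ⟧ d (s ∙ f) (1 ℕ.+ k)
      α₁ = ⟦ x ⟧ (⟦ x ⟧ d) s k
      α₂ = ⟦ x ⟧ (⟦ x ⟧ d) (s ∙ f) (suc k)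
      D  = b * u - a * v
      μ  = c * ((a + b) * (a + b))
      -- b p - a q = b B - (a + b) `Z f`, whence the two coefficients.
      β  = D * b
      γ  = - (D * (a + b))
      y : List (ℤ × Divisor)
      y = map (λ (z , h) → μ * z , h) x ++ (β , B) ∷ (γ , Z f) ∷ []

      form : ℤ → ℤ → ℤ → ℤ
      form p q t = μ * p + (β * q + (γ * t + 0ℤ))

      ⟦y⟧ : ∀ ψ t j → ⟦ y ⟧ ψ t j ≡ form (⟦ x ⟧ ψ t j) (ψ t (suc j)) (op (Z f) ψ t j)
      ⟦y⟧ ψ t j = trans (combine-++ (λ h → op h ψ t j) (map _ x) ((β , B) ∷ (γ , Z f) ∷ []))
        (cong (λ q → q + (β * ψ t (suc j) + (γ * op (Z f) ψ t j + 0ℤ)))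
          (combine-scale (λ h → op h ψ t j) μ x))

      ⟦y⟧-link : ∀ ψ j → ⟦ y ⟧ ψ s j ≡ form (⟦ x ⟧ ψ s j) (ψ s (suc j)) (ψ (s ∙ f) (suc j))
      ⟦y⟧-link ψ j = trans (⟦y⟧ ψ s j) (cong (form _ _) (op-Z-link ψ j ¬l))

      ⟦y⟧-loop : ∀ ψ j → ⟦ y ⟧ ψ (s ∙ f) j
        ≡ form (⟦ x ⟧ ψ (s ∙ f) j) (ψ (s ∙ f) (suc j)) (ψ (s ∙ f) (suc j) - ψ (s ∙ f) j)
      ⟦y⟧-loop ψ j = trans (⟦y⟧ ψ (s ∙ f) j) (cong (form _ _) (op-Z-loop ψ j (Loop-self s f)))

      Y₁ : ⟦ y ⟧ d s (1 ℕ.+ k) ≡ form u a c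
      Y₁ = ⟦y⟧-link d (1 ℕ.+ k)
      Y₂ : ⟦ y ⟧ d (s ∙ f) (2 ℕ.+ k) ≡ form v b (b - c)
      Y₂ = ⟦y⟧-loop d (2 ℕ.+ k)
      Y₃ : ⟦ y ⟧ d (s ∙ f) (1 ℕ.+ k) ≡ form w c (c - g)
      Y₃ = ⟦y⟧-loop d (1 ℕ.+ k)

      Q₁ : ⟦ y ⟧ (⟦ y ⟧ d) s k ≡ form (form α₁ u w) (form u a c) (form w c (c - g))
      Q₁ = begin
        ⟦ y ⟧ (⟦ y ⟧ d) s k
          ≡⟨ ⟦y⟧-link (⟦ y ⟧ d) k ⟩
        form (⟦ x ⟧ (⟦ y ⟧ d) s k) (⟦ y ⟧ d s (1 ℕ.+ k)) (⟦ y ⟧ d (s ∙ f) (1 ℕ.+ k))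
          ≡⟨ cong (λ t → form t (⟦ y ⟧ d s (1 ℕ.+ k)) (⟦ y ⟧ d (s ∙ f) (1 ℕ.+ k)))
               (trans (⟦⟧-comm x y r s k) (⟦y⟧-link (⟦ x ⟧ d) k)) ⟩
        form (form α₁ u w) (⟦ y ⟧ d s (1 ℕ.+ k)) (⟦ y ⟧ d (s ∙ f) (1 ℕ.+ k))
          ≡⟨ cong₂ (form (form α₁ u w)) Y₁ Y₃ ⟩
        form (form α₁ u w) (form u a c) (form w c (c - g)) ∎

      Q₂ : ⟦ y ⟧ (⟦ y ⟧ d) (s ∙ f) (suc k)
         ≡ form (form α₂ v (v - w)) (form v b (b - c)) (form v b (b - c) - form w c (c - g))
      Q₂ = begin
        ⟦ y ⟧ (⟦ y ⟧ d) (s ∙ f) (suc k)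
          ≡⟨ ⟦y⟧-loop (⟦ y ⟧ d) (suc k) ⟩
        form (⟦ x ⟧ (⟦ y ⟧ d) (s ∙ f) (suc k)) (⟦ y ⟧ d (s ∙ f) (2 ℕ.+ k))
          (⟦ y ⟧ d (s ∙ f) (2 ℕ.+ k) - ⟦ y ⟧ d (s ∙ f) (1 ℕ.+ k))
          ≡⟨ cong (λ t → form t (⟦ y ⟧ d (s ∙ f) (2 ℕ.+ k))
                 (⟦ y ⟧ d (s ∙ f) (2 ℕ.+ k) - ⟦ y ⟧ d (s ∙ f) (1 ℕ.+ k)))
               (trans (⟦⟧-comm x y r (s ∙ f) (suc k)) (⟦y⟧-loop (⟦ x ⟧ d) (suc k))) ⟩
        form (form α₂ v (v - w)) (⟦ y ⟧ d (s ∙ f) (2 ℕ.+ k))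
          (⟦ y ⟧ d (s ∙ f) (2 ℕ.+ k) - ⟦ y ⟧ d (s ∙ f) (1 ℕ.+ k))
          ≡⟨ cong₂ (λ p q → form (form α₂ v (v - w)) p (p - q)) Y₂ Y₃ ⟩
        form (form α₂ v (v - w)) (form v b (b - c)) (form v b (b - c) - form w c (c - g)) ∎

      B-value₁ : ∀ a b c u μ D → μ * u + (D * b * a + (- (D * (a + b)) * c + 0ℤ))
        ≡ μ * u - D * (c * (a + b) - a * b)
      B-value₁ = solve-∀
      B-value₂ : ∀ a b c v μ D → μ * v + (D * b * b + (- (D * (a + b)) * (b - c) + 0ℤ))
        ≡ μ * v + D * (c * (a + b) - a * b)
      B-value₂ = solve-∀
      -- `F w c (c - g)` enters the two summands with opposite signs, and so does w: this is the
      -- identity Q₁(q,·) = Q₂(p,·).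
      total : ∀ a b c g u v w α₁ α₂ μ D → let
          F = λ p q t → μ * p + (D * b * q + (- (D * (a + b)) * t + 0ℤ)) in
        F (F α₁ u w) (F u a c) (F w c (c - g))
          + F (F α₂ v (v - w)) (F v b (b - c)) (F v b (b - c) - F w c (c - g))
        ≡ μ * μ * (α₁ + α₂) + (1ℤ + 1ℤ) * μ * D * (b * u - a * v) - D * D * (a + b) * (c * (a + b) - a * b)
      total = solve-∀

  hodge-Θ : ∀ {d} f L → Resp d → (∀ s → d s 0 ≡ 0ℤ) → (∀ s → d s 1 ≡ 0ℤ) →
    (∀ s k → 0ℤ < d s (2 ℕ.+ k)) →
    (∀ {k} → k ℕ.≤ L → HodgeIndex d k) → ∀ {k} → k ℕ.≤ L → HodgeIndex (Θ f d) k
  hodge-Θ {d} f L r d0 d1 pos hodge {k} k≤L s x =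
    subst₂ _≤_ (cong (λ t → Θ f d s (2 ℕ.+ k) * t) (sym (⟦⟧²-Θ x f r d0 d1 s k)))
      (cong (λ t → t * t) (sym (⟦⟧-Θ x f r d0 s (1 ℕ.+ k))))
      (go k k≤L (loop? s f))
    where
    go : ∀ k → k ℕ.≤ L → Dec (Loop s f) →
      Θ f d s (2 ℕ.+ k) * Θ f (⟦ x ⟧ (⟦ x ⟧ d)) s k
      ≤ Θ f (⟦ x ⟧ d) s (1 ℕ.+ k) * Θ f (⟦ x ⟧ d) s (1 ℕ.+ k)
    go k k≤L (yes l) = subst₂ _≤_
      (sym (cong₂ _*_ (Θ-loop d (2 ℕ.+ k) l) (Θ-loop _ k l)))
      (cong (λ t → t * t) (sym (Θ-loop _ (1 ℕ.+ k) l)))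
      (hodge k≤L s x)
    -- At the lowest level the form of the deletion would have level -1 and is absent. Only the form
    -- of the contraction remains, and no gluing takes place.
    go zero k≤L (no ¬l) = subst₂ _≤_
      (sym (cong₂ _*_ (trans (Θ-suc d 1 ¬l) (trans (cong (λ t → t + d (s ∙ f) 2) (d1 s)) (+-identityˡ (d (s ∙ f) 2))))
                      (Θ-zero _ ¬l)))
      (cong (λ t → t * t) (sym (trans (Θ-suc _ 0 ¬l)
        (trans (cong (λ t → t + ⟦ x ⟧ d (s ∙ f) 1) (⟦⟧-zero x d0 d1 s)) (+-identityˡ (⟦ x ⟧ d (s ∙ f) 1))))))
      (hodge k≤L (s ∙ f) x)
    go (suc k) k≤L (no ¬l) = subst₂ _≤_
      (sym (cong₂ _*_ (Θ-suc d (2 ℕ.+ k) ¬l) (Θ-suc _ k ¬l)))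
      (cong (λ t → t * t) (sym (Θ-suc _ (1 ℕ.+ k) ¬l)))
      (hodge-link s f k r ¬l (pos s k) (pos (s ∙ f) (suc k)) (pos (s ∙ f) k)
        (hodge (ℕ.<⇒≤ k≤L)) (hodge k≤L) x)

  hodge-count : ∀ {u} E L → Resp u → (∀ s → u s 0 ≡ 0ℤ) → (∀ s → u s 1 ≡ 0ℤ) →
    (∀ s k → 0ℤ < u s (2 ℕ.+ k)) →
    (∀ {k} → k ℕ.≤ L → HodgeIndex u k) → ∀ {k} → k ℕ.≤ L → HodgeIndex (count u E) k
  hodge-count []      L r u0 u1 pos hodge = hodge
  hodge-count (f ∷ E) L r u0 u1 pos hodge = hodge-Θ f L (count-resp E r)
    (count-0 E 0 u0 u0 ℕ.z≤n) (count-0 E 1 u0 u1 ℕ.≤-refl) (count-pos E u0 u1 pos)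
    (hodge-count E L r u0 u1 pos hodge)

  log-concave-count : ∀ {d k} → HodgeIndex d k → ∀ s → d s k * d s (2 ℕ.+ k) ≤ d s (1 ℕ.+ k) * d s (1 ℕ.+ k)
  log-concave-count {d} {k} hodge s = subst₂ _≤_
    (trans (cong (λ t → d s (2 ℕ.+ k) * t) (trans (unit (⟦ (1ℤ , A) ∷ [] ⟧ d s k)) (unit (d s k)))) (*-comm (d s (2 ℕ.+ k)) (d s k)))
    (cong (λ t → t * t) (unit (d s (1 ℕ.+ k))))
    (hodge s ((1ℤ , A) ∷ []))
    where
    unit : ∀ p → 1ℤ * p + 0ℤ ≡ p
    unit = solve-∀

-- The intersection form at the start of the recursion

module Base (M : FlatSystem) where
  open Calculus M
  open Lorentz M

  -- A non-loop is parallel to itself, being a loop after its own contraction. A, B and the loops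
  -- are related to nothing, so this is only a partial equivalence.
  Parallel : State → Divisor → Divisor → Set
  Parallel s (Z f) (Z g) = ¬ Loop s f × ¬ Loop s g × Loop (s ∙ f) g
  Parallel s _     _     = ⊥

  parallel? : ∀ s g h → Dec (Parallel s g h)
  parallel? s A     h     = no λ ()
  parallel? s B     h     = no λ ()
  parallel? s (Z f) A     = no λ ()
  parallel? s (Z f) B     = no λ ()
  parallel? s (Z f) (Z g) = ¬? (loop? s f) ×-dec (¬? (loop? s g) ×-dec loop? (s ∙ f) g)

  Parallel-sym : ∀ {s} g h → Parallel s g h → Parallel s h g
  Parallel-sym (Z f) (Z g) (¬l , ¬m , p) = ¬m , ¬l , parallel-sym ¬m p

  Parallel-trans : ∀ {s} g h i → Parallel s g h → Parallel s h i → Parallel s g i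
  Parallel-trans (Z f) (Z g) (Z h) (¬l , ¬m , p) (_ , ¬n , q) =
    ¬l , ¬n , Loop-resp (≈-sym (exchange ¬m p)) q

  module _ (ρ : State → ℤ) (T : ℤ) (U : ℕ → ℤ)
           (ρ-link : ∀ s f → ¬ Loop s f → ρ (s ∙ f) ≡ T * ρ s) where

    weight : Fn
    weight s k = ρ s * U k

    private
      α′ β′ : ∀ {P : Set} → Dec P → ℤ
      α′ (yes _) = - 1ℤ
      α′ (no _)  = 0ℤ
      β′ (yes _) = 1ℤ
      β′ (no _)  = T

      -- The class g acts on the weight as α A + β B: contracting a non-loop multiplies ρ by T, so
      -- its `Z` acts as T B, and that of a loop as B - A.
      α β : State → Divisor → ℤ
      α s A     = 1ℤ
      α s B     = 0ℤ
      α s (Z f) = α′ (loop? s f)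
      β s A     = 0ℤ
      β s B     = 1ℤ
      β s (Z f) = β′ (loop? s f)

      α′-yes : ∀ {P : Set} (d : Dec P) → P → α′ d ≡ - 1ℤ
      α′-yes (yes _) p = refl
      α′-yes (no ¬p) p = contradiction p ¬p
      α′-no : ∀ {P : Set} (d : Dec P) → ¬ P → α′ d ≡ 0ℤ
      α′-no (yes p) ¬p = contradiction p ¬p
      α′-no (no _)  ¬p = refl
      β′-yes : ∀ {P : Set} (d : Dec P) → P → β′ d ≡ 1ℤ
      β′-yes (yes _) p = refl
      β′-yes (no ¬p) p = contradiction p ¬p
      β′-no : ∀ {P : Set} (d : Dec P) → ¬ P → β′ d ≡ T
      β′-no (yes p) ¬p = contradiction p ¬p
      β′-no (no _)  ¬p = refl

      op-weight : ∀ g s k → op g weight s k ≡ ρ s * (α s g * U k + β s g * U (suc k))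
      op-weight A s k = lemma (ρ s) (U k) (U (suc k))
        where
        lemma : ∀ r p q → r * p ≡ r * (1ℤ * p + 0ℤ * q)
        lemma = solve-∀
      op-weight B s k = lemma (ρ s) (U k) (U (suc k))
        where
        lemma : ∀ r p q → r * q ≡ r * (0ℤ * p + 1ℤ * q)
        lemma = solve-∀
      op-weight (Z f) s k with loop? s f
      ... | yes _ = lemma (ρ s) (U k) (U (suc k))
        where
        lemma : ∀ r p q → r * q - r * p ≡ r * (- 1ℤ * p + 1ℤ * q)
        lemma = solve-∀
      ... | no ¬l = trans (cong (λ r → r * U (suc k)) (ρ-link s f ¬l)) (lemma T (ρ s) (U k) (U (suc k)))
        where
        lemma : ∀ t r p q → t * r * q ≡ r * (0ℤ * p + t * q)
        lemma = solve-∀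

      -- For parallel non-loops the second class meets a loop, and the product is T B (B - A)
      -- instead of the T² B² predicted by α and β. The difference T ((T - 1) B² + A B) is the
      -- defect.
      defect : ℕ → ℤ
      defect k = T * ((T - 1ℤ) * U (2 ℕ.+ k) + U (1 ℕ.+ k))

      entry : ℤ → ℤ → ℤ → ℤ → ℤ → ℤ → ℕ → ℤ
      entry r a b a′ b′ i k =
        r * (a * a′ * U k + (a * b′ + b * a′) * U (1 ℕ.+ k) + b * b′ * U (2 ℕ.+ k) - defect k * i)

      op²-weight : ∀ g h s k → op g (op h weight) s k
        ≡ entry (ρ s) (α s g) (β s g) (α s h) (β s h) (indicator (parallel? s h g)) k
      op²-weight A h s k = trans (op-weight h s k) (trans
        (lemma (ρ s) (α s h) (β s h) (U k) (U (1 ℕ.+ k)) (U (2 ℕ.+ k)) (defect k))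
        (cong (λ i → entry (ρ s) 1ℤ 0ℤ (α s h) (β s h) i k)
          (sym (indicator-no (parallel? s h A) (never h)))))
        where
        never : ∀ h → ¬ Parallel s h A
        never A     ()
        never B     ()
        never (Z _) ()
        lemma : ∀ r a b p q t w →
          r * (a * p + b * q) ≡ r * (1ℤ * a * p + (1ℤ * b + 0ℤ * a) * q + 0ℤ * b * t - w * 0ℤ)
        lemma = solve-∀
      op²-weight B h s k = trans (op-weight h s (1 ℕ.+ k)) (trans
        (lemma (ρ s) (α s h) (β s h) (U k) (U (1 ℕ.+ k)) (U (2 ℕ.+ k)) (defect k))
        (cong (λ i → entry (ρ s) 0ℤ 1ℤ (α s h) (β s h) i k)
          (sym (indicator-no (parallel? s h B) (never h)))))
        where
        never : ∀ h → ¬ Parallel s h B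
        never A     ()
        never B     ()
        never (Z _) ()
        lemma : ∀ r a b p q t w →
          r * (a * q + b * t) ≡ r * (0ℤ * a * p + (0ℤ * b + 1ℤ * a) * q + 1ℤ * b * t - w * 0ℤ)
        lemma = solve-∀
      op²-weight (Z f) h s k = go (loop? s f)
        where
        open ≡-Reasoning
        loop-case : ∀ r a b p q t w → r * (a * q + b * t) - r * (a * p + b * q)
          ≡ r * (- 1ℤ * a * p + (- 1ℤ * b + 1ℤ * a) * q + 1ℤ * b * t - w * 0ℤ)
        loop-case = solve-∀
        link-case : ∀ τ r a b p q t w → τ * r * (a * q + b * t)
          ≡ r * (0ℤ * a * p + (0ℤ * b + τ * a) * q + τ * b * t - w * 0ℤ)
        link-case = solve-∀
        parallel-case : ∀ τ r p q t → τ * r * (- 1ℤ * q + 1ℤ * t)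
          ≡ r * (0ℤ * 0ℤ * p + (0ℤ * τ + τ * 0ℤ) * q + τ * τ * t - τ * ((τ - 1ℤ) * t + q) * 1ℤ)
        parallel-case = solve-∀
        target : ℤ → ℤ → ℤ → ℤ → ℤ → ℤ
        target a b a′ b′ i = entry (ρ s) a b a′ b′ i k
        link : ¬ Loop s f → ∀ h → op (Z f) (op h weight) s k
          ≡ T * ρ s * (α (s ∙ f) h * U (1 ℕ.+ k) + β (s ∙ f) h * U (2 ℕ.+ k))
        link ¬l h = trans (op-Z-link (op h weight) k ¬l) (trans (op-weight h (s ∙ f) (1 ℕ.+ k))
          (cong (λ r → r * (α (s ∙ f) h * U (1 ℕ.+ k) + β (s ∙ f) h * U (2 ℕ.+ k))) (ρ-link s f ¬l)))
        stable : ¬ Loop s f → ∀ h → α (s ∙ f) h ≡ α s h → β (s ∙ f) h ≡ β s h → ¬ Parallel s h (Z f) →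
          op (Z f) (op h weight) s k
          ≡ target (α s (Z f)) (β s (Z f)) (α s h) (β s h) (indicator (parallel? s h (Z f)))
        stable ¬l h eα eβ ¬p = begin
          op (Z f) (op h weight) s k
            ≡⟨ link ¬l h ⟩
          T * ρ s * (α (s ∙ f) h * U (1 ℕ.+ k) + β (s ∙ f) h * U (2 ℕ.+ k))
            ≡⟨ cong₂ (λ a b → T * ρ s * (a * U (1 ℕ.+ k) + b * U (2 ℕ.+ k))) eα eβ ⟩
          T * ρ s * (α s h * U (1 ℕ.+ k) + β s h * U (2 ℕ.+ k))
            ≡⟨ link-case T (ρ s) (α s h) (β s h) (U k) (U (1 ℕ.+ k)) (U (2 ℕ.+ k)) (defect k) ⟩
          target 0ℤ T (α s h) (β s h) 0ℤ
            ≡⟨ cong₂ (λ a b → target a b (α s h) (β s h) 0ℤ) (α′-no (loop? s f) ¬l) (β′-no (loop? s f) ¬l) ⟨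
          target (α s (Z f)) (β s (Z f)) (α s h) (β s h) 0ℤ
            ≡⟨ cong (target (α s (Z f)) (β s (Z f)) (α s h) (β s h)) (indicator-no (parallel? s h (Z f)) ¬p) ⟨
          target (α s (Z f)) (β s (Z f)) (α s h) (β s h) (indicator (parallel? s h (Z f))) ∎
        link-link : ¬ Loop s f → ∀ g → Dec (Loop s g) → Dec (Loop (s ∙ f) g) →
          op (Z f) (op (Z g) weight) s k
          ≡ target (α s (Z f)) (β s (Z f)) (α s (Z g)) (β s (Z g)) (indicator (parallel? s (Z g) (Z f)))
        link-link ¬l g (yes m) _ = stable ¬l (Z g)
          (trans (α′-yes (loop? (s ∙ f) g) (Loop-mono f m)) (sym (α′-yes (loop? s g) m)))
          (trans (β′-yes (loop? (s ∙ f) g) (Loop-mono f m)) (sym (β′-yes (loop? s g) m)))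
          (λ (¬m , _) → ¬m m)
        link-link ¬l g (no ¬m) (no ¬p) = stable ¬l (Z g)
          (trans (α′-no (loop? (s ∙ f) g) ¬p) (sym (α′-no (loop? s g) ¬m)))
          (trans (β′-no (loop? (s ∙ f) g) ¬p) (sym (β′-no (loop? s g) ¬m)))
          (λ (_ , _ , q) → ¬p (parallel-sym ¬l q))
        link-link ¬l g (no ¬m) (yes p) = begin
          op (Z f) (op (Z g) weight) s k
            ≡⟨ link ¬l (Z g) ⟩
          T * ρ s * (α (s ∙ f) (Z g) * U (1 ℕ.+ k) + β (s ∙ f) (Z g) * U (2 ℕ.+ k))
            ≡⟨ cong₂ (λ a b → T * ρ s * (a * U (1 ℕ.+ k) + b * U (2 ℕ.+ k)))
                 (α′-yes (loop? (s ∙ f) g) p) (β′-yes (loop? (s ∙ f) g) p) ⟩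
          T * ρ s * (- 1ℤ * U (1 ℕ.+ k) + 1ℤ * U (2 ℕ.+ k))
            ≡⟨ parallel-case T (ρ s) (U k) (U (1 ℕ.+ k)) (U (2 ℕ.+ k)) ⟩
          target 0ℤ T 0ℤ T 1ℤ
            ≡⟨ cong₂ (λ a b → target a b 0ℤ T 1ℤ) (α′-no (loop? s f) ¬l) (β′-no (loop? s f) ¬l) ⟨
          target (α s (Z f)) (β s (Z f)) 0ℤ T 1ℤ
            ≡⟨ cong₂ (λ a b → target (α s (Z f)) (β s (Z f)) a b 1ℤ)
                 (α′-no (loop? s g) ¬m) (β′-no (loop? s g) ¬m) ⟨
          target (α s (Z f)) (β s (Z f)) (α s (Z g)) (β s (Z g)) 1ℤ
            ≡⟨ cong (target (α s (Z f)) (β s (Z f)) (α s (Z g)) (β s (Z g)))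
                 (indicator-yes (parallel? s (Z g) (Z f)) (¬m , ¬l , parallel-sym ¬m p)) ⟨
          target (α s (Z f)) (β s (Z f)) (α s (Z g)) (β s (Z g)) (indicator (parallel? s (Z g) (Z f))) ∎
        go : Dec (Loop s f) → op (Z f) (op h weight) s k
          ≡ target (α s (Z f)) (β s (Z f)) (α s h) (β s h) (indicator (parallel? s h (Z f)))
        go (yes l) = begin
          op (Z f) (op h weight) s k
            ≡⟨ op-Z-loop (op h weight) k l ⟩
          op h weight s (1 ℕ.+ k) - op h weight s k
            ≡⟨ cong₂ _-_ (op-weight h s (1 ℕ.+ k)) (op-weight h s k) ⟩
          ρ s * (α s h * U (1 ℕ.+ k) + β s h * U (2 ℕ.+ k)) - ρ s * (α s h * U k + β s h * U (1 ℕ.+ k))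
            ≡⟨ loop-case (ρ s) (α s h) (β s h) (U k) (U (1 ℕ.+ k)) (U (2 ℕ.+ k)) (defect k) ⟩
          target (- 1ℤ) 1ℤ (α s h) (β s h) 0ℤ
            ≡⟨ cong₂ (λ a b → target a b (α s h) (β s h) 0ℤ) (α′-yes (loop? s f) l) (β′-yes (loop? s f) l) ⟨
          target (α s (Z f)) (β s (Z f)) (α s h) (β s h) 0ℤ
            ≡⟨ cong (target (α s (Z f)) (β s (Z f)) (α s h) (β s h)) (indicator-no (parallel? s h (Z f)) (never h)) ⟨
          target (α s (Z f)) (β s (Z f)) (α s h) (β s h) (indicator (parallel? s h (Z f))) ∎
          where
          never : ∀ h → ¬ Parallel s h (Z f)
          never (Z g) (_ , ¬l , _) = ¬l l
        go (no ¬l) = split ¬l h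
          where
          split : ¬ Loop s f → ∀ h → op (Z f) (op h weight) s k
            ≡ target (α s (Z f)) (β s (Z f)) (α s h) (β s h) (indicator (parallel? s h (Z f)))
          split ¬l A     = stable ¬l A refl refl λ ()
          split ¬l B     = stable ¬l B refl refl λ ()
          split ¬l (Z g) = link-link ¬l g (loop? s g) (loop? (s ∙ f) g)

      combine₃ : ∀ {G : Set} p q t (φ ψ χ : G → ℤ) x →
        combine (λ g → p * φ g + (q * ψ g + t * χ g)) x
        ≡ p * combine φ x + (q * combine ψ x + t * combine χ x)
      combine₃ p q t φ ψ χ x = begin
        combine (λ g → p * φ g + (q * ψ g + t * χ g)) x
          ≡⟨ combine-linear p φ _ x ⟩
        p * combine φ x + combine (λ g → q * ψ g + t * χ g) x
          ≡⟨ cong (λ z → p * combine φ x + z) (combine-linear q ψ _ x) ⟩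
        p * combine φ x + (q * combine ψ x + combine (λ g → t * χ g) x)
          ≡⟨ cong (λ z → p * combine φ x + (q * combine ψ x + z)) (begin
               combine (λ g → t * χ g) x                    ≡⟨ combine-cong (λ g → sym (+-identityʳ _)) x ⟩
               combine (λ g → t * χ g + 0ℤ) x               ≡⟨ combine-linear t χ _ x ⟩
               t * combine χ x + combine (λ _ → 0ℤ) x       ≡⟨ cong (λ z → t * combine χ x + z) (combine-0 x) ⟩
               t * combine χ x + 0ℤ                         ≡⟨ +-identityʳ _ ⟩
               t * combine χ x ∎) ⟩
        p * combine φ x + (q * combine ψ x + t * combine χ x) ∎
        where open ≡-Reasoning

    module _ (ρ-resp : ∀ s t → s ≈ t → ρ s ≡ ρ t) where

      weight-resp : Resp weight
      weight-resp {s} {t} eq k = cong (λ r → r * U k) (ρ-resp s t eq)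

      -- The form is r times a binary form in a and b, the totals of α and β over x, minus r times
      -- `defect` times the Gram form G of `Parallel`. In the Hodge difference the binary part
      -- leaves only its discriminant, a² (U₁² - U₀ U₂), and the Gram part leaves U₂ `defect` G,
      -- both nonnegative; `gap` is this identity.
      hodge-weight : 1ℤ ≤ T → ∀ k → 0ℤ ≤ U (1 ℕ.+ k) → 0ℤ ≤ U (2 ℕ.+ k) →
        U k * U (2 ℕ.+ k) ≤ U (1 ℕ.+ k) * U (1 ℕ.+ k) → HodgeIndex weight k
      hodge-weight 1≤T k 0≤U₁ 0≤U₂ concave s x = 0≤i-j⇒j≤i (subst (0ℤ ≤_)
        (begin
          _ ≡⟨ gap r a b (U k) (U (1 ℕ.+ k)) (U (2 ℕ.+ k)) (defect k) G ⟩
          r * (a * U (1 ℕ.+ k) + b * U (2 ℕ.+ k)) * (r * (a * U (1 ℕ.+ k) + b * U (2 ℕ.+ k)))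
            - r * U (2 ℕ.+ k) * (P * a + (Q * b + R * G))
            ≡⟨ cong₂ (λ p q → p * p - r * U (2 ℕ.+ k) * q) linear quadratic ⟨
          ⟦ x ⟧ weight s (1 ℕ.+ k) * ⟦ x ⟧ weight s (1 ℕ.+ k) - r * U (2 ℕ.+ k) * ⟦ x ⟧ (⟦ x ⟧ weight) s k ∎)
        (0≤i*j (0≤i*i r) (+-mono-≤
          (0≤i*j (0≤i*i a) (i≤j⇒0≤j-i concave))
          (0≤i*j (0≤i*j 0≤U₂ (0≤i*j (≤-trans (+≤+ ℕ.z≤n) 1≤T)
            (+-mono-≤ (0≤i*j (i≤j⇒0≤j-i 1≤T) 0≤U₂) 0≤U₁)))
            (0≤gram (Parallel s) (parallel? s) (Parallel-sym _ _) (Parallel-trans _ _ _) x)))))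
        where
        open ≡-Reasoning
        r a b G P Q R : ℤ
        r = ρ s
        a = combine (α s) x
        b = combine (β s) x
        κ : Divisor → Divisor → ℤ
        κ g h = indicator (parallel? s g h)
        G = combine (λ g → combine (κ g) x) x
        P = r * (a * U k + b * U (1 ℕ.+ k))
        Q = r * (a * U (1 ℕ.+ k) + b * U (2 ℕ.+ k))
        R = - (r * defect k)

        linear : ⟦ x ⟧ weight s (1 ℕ.+ k) ≡ Q
        linear = begin
          combine (λ g → op g weight s (1 ℕ.+ k)) x
            ≡⟨ combine-cong (λ g → trans (op-weight g s (1 ℕ.+ k))
                 (lemma r (α s g) (β s g) (U (1 ℕ.+ k)) (U (2 ℕ.+ k)))) x ⟩
          combine (λ g → r * U (1 ℕ.+ k) * α s g + (r * U (2 ℕ.+ k) * β s g + 0ℤ * 0ℤ)) x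
            ≡⟨ combine₃ (r * U (1 ℕ.+ k)) (r * U (2 ℕ.+ k)) 0ℤ (α s) (β s) (λ _ → 0ℤ) x ⟩
          r * U (1 ℕ.+ k) * a + (r * U (2 ℕ.+ k) * b + 0ℤ * combine (λ _ → 0ℤ) x)
            ≡⟨ lemma′ r a b (U (1 ℕ.+ k)) (U (2 ℕ.+ k)) (combine (λ _ → 0ℤ) x) ⟩
          Q ∎
          where
          lemma : ∀ r a b p q → r * (a * p + b * q) ≡ r * p * a + (r * q * b + 0ℤ * 0ℤ)
          lemma = solve-∀
          lemma′ : ∀ r a b p q z → r * p * a + (r * q * b + 0ℤ * z) ≡ r * (a * p + b * q)
          lemma′ = solve-∀

        row : ∀ g → op g (⟦ x ⟧ weight) s k ≡ P * α s g + (Q * β s g + R * combine (κ g) x)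
        row g = begin
          op g (⟦ x ⟧ weight) s k
            ≡⟨ op-⟦⟧ g x weight-resp s k ⟩
          combine (λ h → op h (op g weight) s k) x
            ≡⟨ combine-cong (λ h → trans (op²-weight h g s k)
                 (lemma r (α s h) (β s h) (α s g) (β s g) (U k) (U (1 ℕ.+ k)) (U (2 ℕ.+ k)) (defect k) (κ g h))) x ⟩
          combine (λ h → r * (α s g * U k + β s g * U (1 ℕ.+ k)) * α s h
            + (r * (α s g * U (1 ℕ.+ k) + β s g * U (2 ℕ.+ k)) * β s h + R * κ g h)) x
            ≡⟨ combine₃ (r * (α s g * U k + β s g * U (1 ℕ.+ k)))
                 (r * (α s g * U (1 ℕ.+ k) + β s g * U (2 ℕ.+ k))) R (α s) (β s) (κ g) x ⟩
          r * (α s g * U k + β s g * U (1 ℕ.+ k)) * a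
            + (r * (α s g * U (1 ℕ.+ k) + β s g * U (2 ℕ.+ k)) * b + R * combine (κ g) x)
            ≡⟨ lemma′ r a b (α s g) (β s g) (U k) (U (1 ℕ.+ k)) (U (2 ℕ.+ k)) (R * combine (κ g) x) ⟩
          P * α s g + (Q * β s g + R * combine (κ g) x) ∎
          where
          lemma : ∀ r a b a′ b′ p q t w i →
            r * (a * a′ * p + (a * b′ + b * a′) * q + b * b′ * t - w * i)
            ≡ r * (a′ * p + b′ * q) * a + (r * (a′ * q + b′ * t) * b + - (r * w) * i)
          lemma = solve-∀
          lemma′ : ∀ r a b a′ b′ p q t z →
            r * (a′ * p + b′ * q) * a + (r * (a′ * q + b′ * t) * b + z)
            ≡ r * (a * p + b * q) * a′ + (r * (a * q + b * t) * b′ + z)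
          lemma′ = solve-∀

        quadratic : ⟦ x ⟧ (⟦ x ⟧ weight) s k ≡ P * a + (Q * b + R * G)
        quadratic = trans (combine-cong row x) (combine₃ P Q R (α s) (β s) (λ g → combine (κ g) x) x)

        gap : ∀ r a b p q t w G →
          r * r * (a * a * (q * q - p * t) + t * w * G)
          ≡ r * (a * q + b * t) * (r * (a * q + b * t))
            - r * t * (r * (a * p + b * q) * a + (r * (a * q + b * t) * b + - (r * w) * G))
        gap = solve-∀

-- Graphic matroids

module _ {N : ℕ} where

  Labelling : Set
  Labelling = Fin N → Fin N

  infix 4 _⊑_
  _⊑_ : Labelling → Labelling → Set
  s ⊑ t = ∀ {w x} → s w ≡ s x → t w ≡ t x

  private
    relabel : ∀ {P : Set} → Dec P → Fin N → Fin N → Fin N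
    relabel (yes _) a b = a
    relabel (no _)  a b = b

  merge : Labelling → Fin N → Fin N → Labelling
  merge s u v w = relabel (s w ≟ᶠ s v) (s u) (s w)

  merge-yes : ∀ s u v w → s w ≡ s v → merge s u v w ≡ s u
  merge-yes s u v w eq with s w ≟ᶠ s v
  ... | yes _ = refl
  ... | no ¬p = contradiction eq ¬p

  merge-no : ∀ s u v w → s w ≢ s v → merge s u v w ≡ s w
  merge-no s u v w neq with s w ≟ᶠ s v
  ... | yes p = contradiction p neq
  ... | no _  = refl

  ⊑-merge : ∀ s u v → s ⊑ merge s u v
  ⊑-merge s u v {w} {x} eq with s w ≟ᶠ s v
  ... | yes p = sym (merge-yes s u v x (trans (sym eq) p))
  ... | no ¬p = trans eq (sym (merge-no s u v x (λ q → ¬p (trans eq q))))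

  merge-joins : ∀ s u v → merge s u v u ≡ merge s u v v
  merge-joins s u v with s u ≟ᶠ s v
  ... | yes p = sym (merge-yes s u v v refl)
  ... | no ¬p = sym (merge-yes s u v v refl)

  -- Together with `⊑-merge` and `merge-joins` this is the universal property of the join of
  -- partitions, from which `merge-cong` and `merge-comm` follow formally.
  merge-least : ∀ s u v {t} → s ⊑ t → t u ≡ t v → merge s u v ⊑ t
  merge-least s u v s⊑t eq {w} {x} = go (s w ≟ᶠ s v) (s x ≟ᶠ s v)
    where
    go : Dec (s w ≡ s v) → Dec (s x ≡ s v) → merge s u v w ≡ merge s u v x → _
    go (yes p) (yes q) _  = s⊑t (trans p (sym q))
    go (yes p) (no ¬q) e  = trans (s⊑t p) (trans (sym eq)
      (s⊑t (trans (sym (merge-yes s u v w p)) (trans e (merge-no s u v x ¬q)))))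
    go (no ¬p) (yes q) e  = trans
      (s⊑t (trans (sym (merge-no s u v w ¬p)) (trans e (merge-yes s u v x q)))) (trans eq (sym (s⊑t q)))
    go (no ¬p) (no ¬q) e  = s⊑t (trans (sym (merge-no s u v w ¬p)) (trans e (merge-no s u v x ¬q)))

  merge-cong : ∀ {s t} u v → s ⊑ t → merge s u v ⊑ merge t u v
  merge-cong {s} {t} u v s⊑t =
    merge-least s u v (λ e → ⊑-merge t u v (s⊑t e)) (merge-joins t u v)

  merge-comm : ∀ s u v a b → merge (merge s u v) a b ⊑ merge (merge s a b) u v
  merge-comm s u v a b = merge-least (merge s u v) a b
    (merge-least s u v (λ e → ⊑-merge (merge s a b) u v (⊑-merge s a b e)) (merge-joins (merge s a b) u v))
    (⊑-merge (merge s a b) u v (merge-joins s a b))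

  -- Only the blocks of u and v are united, so a and b, separate before, lie one in each; joining a
  -- to b therefore joins u to v.
  merge-exchange : ∀ s u v a b → s a ≢ s b → merge s u v a ≡ merge s u v b → merge s u v ⊑ merge s a b
  merge-exchange s u v a b neq eq = merge-least s u v (⊑-merge s a b) (go (s a ≟ᶠ s v) (s b ≟ᶠ s v))
    where
    t = merge s a b
    lift = ⊑-merge s a b
    go : Dec (s a ≡ s v) → Dec (s b ≡ s v) → t u ≡ t v
    go (yes p) (yes q) = contradiction (trans p (sym q)) neq
    go (yes p) (no ¬q) = trans
      (lift (trans (sym (merge-yes s u v a p)) (trans eq (merge-no s u v b ¬q))))
      (trans (sym (merge-joins s a b)) (lift p))
    go (no ¬p) (yes q) = trans
      (lift (trans (sym (merge-yes s u v b q)) (trans (sym eq) (merge-no s u v a ¬p))))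
      (trans (merge-joins s a b) (lift q))
    go (no ¬p) (no ¬q) =
      contradiction (trans (sym (merge-no s u v a ¬p)) (trans eq (merge-no s u v b ¬q))) neq

-- The flats of a graphic matroid, as vertex labellings up to renaming of the labels.
-- The second component counts the contracted edges, that is, the rank.
graphic : ℕ → FlatSystem
graphic N = record
  { State     = (Fin N → Fin N) × ℕ
  ; Element   = Fin N × Fin N
  ; _≈_       = λ (s , e) (t , e′) → (s ⊑ t) × (t ⊑ s) × e ≡ e′
  ; _∙_       = λ (s , e) (u , v) → merge s u v , suc e
  ; Loop      = λ (s , _) (u , v) → s u ≡ s v
  ; loop?     = λ (s , _) (u , v) → s u ≟ᶠ s v
  ; ≈-sym     = λ (p , q , e) → (λ {w} {x} → q {w} {x}) , (λ {w} {x} → p {w} {x}) , sym e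
  ; ∙-cong    = λ {(s , _)} {(t , _)} (u , v) (p , q , e) →
      merge-cong {s = s} {t} u v p , merge-cong {s = t} {s} u v q , cong suc e
  ; ∙-comm    = λ (s , _) (u , v) (a , b) → merge-comm s u v a b , merge-comm s a b u v , refl
  ; Loop-resp = λ (p , _) l → p l
  ; Loop-self = λ (s , _) (u , v) → merge-joins s u v
  ; Loop-mono = λ {(s , _)} (u , v) l → ⊑-merge s u v l
  ; exchange  = λ {(s , _)} {(u , v)} {(a , b)} ¬l p →
      merge-exchange s u v a b ¬l p , merge-least s a b (⊑-merge s u v) p , refl
  }

-- The rank of a vertex labelling

∣p[x]≔inside∣ : ∀ {n} (p : Subset n) x → x ∉ p → ∣ p [ x ]≔ inside ∣ ≡ suc ∣ p ∣
∣p[x]≔inside∣ (inside  ∷ p) zero    x∉p = contradiction here x∉p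
∣p[x]≔inside∣ (outside ∷ p) zero    x∉p = refl
∣p[x]≔inside∣ (inside  ∷ p) (suc x) x∉p = cong suc (∣p[x]≔inside∣ p x (x∉p ∘ there))
∣p[x]≔inside∣ (outside ∷ p) (suc x) x∉p = ∣p[x]≔inside∣ p x (x∉p ∘ there)

x∈p[y]≔inside : ∀ {n} {p : Subset n} {x} y → x ≢ y → x ∈ p [ y ]≔ inside → x ∈ p
x∈p[y]≔inside {p = _ ∷ _} zero    x≢y here      = contradiction refl x≢y
x∈p[y]≔inside {p = _ ∷ _} zero    x≢y (there m) = there m
x∈p[y]≔inside {p = _ ∷ _} (suc y) x≢y here      = here
x∈p[y]≔inside {p = _ ∷ _} (suc y) x≢y (there m) = there (x∈p[y]≔inside y (x≢y ∘ cong suc) m)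

module Rank (n : ℕ) where
  open Calculus (graphic (suc n))

  -- Ties the stored number to the rank, since an arbitrary state may carry any number. Labels are
  -- representatives of their blocks, and `moved` collects the vertices that represent none.
  -- Contracting a non-loop (u , v) adds exactly one vertex to it, the former representative of v.
  record Ranked (s : State) : Set where
    field
      idem  : ∀ w → proj₁ s (proj₁ s w) ≡ proj₁ s w
      moved : Subset (suc n)
      size  : ∣ moved ∣ ≡ proj₂ s
      ∈⇒≢   : ∀ {w} → w ∈ moved → proj₁ s w ≢ w
      ∉⇒≡   : ∀ {w} → w ∉ moved → proj₁ s w ≡ w

  open Ranked

  Ranked-id : Ranked (id , 0)
  Ranked-id = record
    { idem  = λ w → refl
    ; moved = ∅
    ; size  = ∣⊥∣≡0 (suc n)
    ; ∈⇒≢   = λ w∈∅ → contradiction w∈∅ ∉⊥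
    ; ∉⇒≡   = λ _ → refl
    }

  Ranked-∙ : ∀ {s f} → Ranked s → ¬ Loop s f → Ranked (s ∙ f)
  Ranked-∙ {s , e} {u , v} R ¬l = record
    { idem  = λ w → idem′ w (s w ≟ᶠ s v)
    ; moved = moved R [ s v ]≔ inside
    ; size  = trans (∣p[x]≔inside∣ (moved R) (s v) (λ b∈ → ∈⇒≢ R b∈ (idem R v))) (cong suc (size R))
    ; ∈⇒≢   = λ {w} → ∈⇒≢′ w (w ≟ᶠ s v) (s w ≟ᶠ s v)
    ; ∉⇒≡   = λ {w} → ∉⇒≡′ w (w ≟ᶠ s v)
    }
    where
    t = merge s u v
    idem′ : ∀ w → Dec (s w ≡ s v) → t (t w) ≡ t w
    idem′ w (yes p) = begin
      t (t w)  ≡⟨ cong t (merge-yes s u v w p) ⟩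
      t (s u)  ≡⟨ merge-no s u v (s u) (λ q → ¬l (trans (sym (idem R u)) q)) ⟩
      s (s u)  ≡⟨ idem R u ⟩
      s u      ≡⟨ merge-yes s u v w p ⟨
      t w      ∎
      where open ≡-Reasoning
    idem′ w (no ¬p) = begin
      t (t w)  ≡⟨ cong t (merge-no s u v w ¬p) ⟩
      t (s w)  ≡⟨ merge-no s u v (s w) (λ q → ¬p (trans (sym (idem R w)) q)) ⟩
      s (s w)  ≡⟨ idem R w ⟩
      s w      ≡⟨ merge-no s u v w ¬p ⟨
      t w      ∎
      where open ≡-Reasoning
    ∈⇒≢′ : ∀ w → Dec (w ≡ s v) → Dec (s w ≡ s v) → w ∈ moved R [ s v ]≔ inside → t w ≢ w
    ∈⇒≢′ w (yes refl) _ _ eq = ¬l (trans (sym (merge-yes s u v w (idem R v))) eq)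
    ∈⇒≢′ w (no w≢b) (yes p) w∈ eq = ∈⇒≢ R (x∈p[y]≔inside (s v) w≢b w∈)
      (trans (cong s w≡su) (trans (idem R u) (sym w≡su)))
      where w≡su = trans (sym eq) (merge-yes s u v w p)
    ∈⇒≢′ w (no w≢b) (no ¬p) w∈ eq =
      ∈⇒≢ R (x∈p[y]≔inside (s v) w≢b w∈) (trans (sym (merge-no s u v w ¬p)) eq)
    ∉⇒≡′ : ∀ w → Dec (w ≡ s v) → w ∉ moved R [ s v ]≔ inside → t w ≡ w
    ∉⇒≡′ w (yes refl) w∉ = contradiction ([]≔-updates (moved R) (s v)) w∉
    ∉⇒≡′ w (no w≢b)   w∉ = trans (merge-no s u v w (λ p → w≢b (trans (sym sw≡w) p))) sw≡w
      where
      sw≡w : s w ≡ w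
      sw≡w = ∉⇒≡ R (λ w∈ → w∉ ([]≔-minimal (moved R) w (s v) w≢b w∈))

  Top : State → Set
  Top (s , _) = ∀ w → s w ≡ s zero

  top? : ∀ s → Dec (Top s)
  top? (s , _) = all? (λ w → s w ≟ᶠ s zero)

  Top-resp : ∀ {s t} → s ≈ t → Top s → Top t
  Top-resp {s , _} {t , _} (s⊑t , _) top w = s⊑t {w} {zero} (top w)

  private
    others : ∀ (z : Fin (suc n)) → ∣ ∁ ⁅ z ⁆ ∣ ≡ n
    others z = trans (∣∁p∣≡n∸∣p∣ ⁅ z ⁆) (cong (suc n ℕ.∸_) (∣⁅x⁆∣≡1 z))

    moved⊆others : ∀ {s} (R : Ranked s) → moved R ⊆ ∁ ⁅ proj₁ s zero ⁆
    moved⊆others {s} R {w} w∈ = x∉p⇒x∈∁p λ w∈z →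
      ∈⇒≢ R w∈ (subst (λ w → proj₁ s w ≡ w) (sym (x∈⁅y⁆⇒x≡y _ w∈z)) (idem R zero))

  rank-top : ∀ {s} → Ranked s → Top s → proj₂ s ≡ n
  rank-top {s , e} R top = trans (sym (size R)) (trans
    (ℕ.≤-antisym (p⊆q⇒∣p∣≤∣q∣ (moved⊆others R)) (p⊆q⇒∣p∣≤∣q∣ others⊆moved)) (others (s zero)))
    where
    others⊆moved : ∁ ⁅ s zero ⁆ ⊆ moved R
    others⊆moved {w} w∈ with w ∈? moved R
    ... | yes w∈m = w∈m
    ... | no w∉m  = contradiction
      (subst (_∈ ⁅ s zero ⁆) (trans (sym (top w)) (∉⇒≡ R w∉m)) (x∈⁅x⁆ (s zero))) (x∈∁p⇒x∉p w∈)

  -- A second block has a representative `s w` of its own, so `moved` misses two vertices.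
  rank-¬top : ∀ {s} → Ranked s → ¬ Top s → suc (proj₂ s) ℕ.≤ n
  rank-¬top {s , e} R ¬top with w , sw≢z ← ¬∀⟶∃¬ (suc n) (λ w → s w ≡ s zero) (λ w → s w ≟ᶠ s zero) ¬top =
    subst₂ ℕ._<_ (size R) (others (s zero)) (p⊂q⇒∣p∣<∣q∣
      ( moved⊆others R
      , s w
      , x∉p⇒x∈∁p (λ m → sw≢z (x∈⁅y⁆⇒x≡y _ m))
      , λ m → ∈⇒≢ R m (idem R w)))

-- Perturbation and limit

module Bounds (M : FlatSystem) where
  open Calculus M

  count-linear : ∀ w φ ψ E s k →
    count (λ s k → w * φ s k + ψ s k) E s k ≡ w * count φ E s k + count ψ E s k
  count-linear w φ ψ []      s k = refl
  count-linear w φ ψ (f ∷ E) s k = trans (Θ-cong f (count-linear w φ ψ E) s k)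
    (Θ-linear f w (count φ E) (count ψ E) s k)

  count-null : ∀ E s k → count (λ _ _ → 0ℤ) E s k ≡ 0ℤ
  count-null []      s k = refl
  count-null (f ∷ E) s k = trans (Θ-cong f (count-null E) s k) (Θ-0 f s k)

  -- Relative to a predicate P because the comparison with `spanning` holds only at states whose
  -- stored number is their rank. The recursion contracts non-loops only and so stays within P.
  count-mono : ∀ {P : State → Set} → (∀ {s f} → P s → ¬ Loop s f → P (s ∙ f)) →
    ∀ {φ ψ} → (∀ {s} → P s → ∀ k → φ s k ≤ ψ s k) →
    ∀ E {s} → P s → ∀ k → count φ E s k ≤ count ψ E s k
  count-mono P-∙ φ≤ψ []      p k = φ≤ψ p k
  count-mono {P} P-∙ {φ} {ψ} φ≤ψ (f ∷ E) {s} p k = go k (loop? s f)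
    where
    rec : ∀ {s} → P s → ∀ k → count φ E s k ≤ count ψ E s k
    rec = count-mono P-∙ φ≤ψ E
    go : ∀ k → Dec (Loop s f) → count φ (f ∷ E) s k ≤ count ψ (f ∷ E) s k
    go k       (yes l) = subst₂ _≤_ (sym (Θ-loop _ k l)) (sym (Θ-loop _ k l)) (rec p k)
    go zero    (no ¬l) = subst₂ _≤_ (sym (Θ-zero _ ¬l)) (sym (Θ-zero _ ¬l)) (rec (P-∙ p ¬l) 0)
    go (suc k) (no ¬l) = subst₂ _≤_ (sym (Θ-suc _ k ¬l)) (sym (Θ-suc _ k ¬l))
      (+-mono-≤ (rec p k) (rec (P-∙ p ¬l) (suc k)))

  count-nonneg : ∀ {φ} → (∀ s k → 0ℤ ≤ φ s k) → ∀ E s k → 0ℤ ≤ count φ E s k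
  count-nonneg 0≤φ []      s k = 0≤φ s k
  count-nonneg {φ} 0≤φ (f ∷ E) s k = go k (loop? s f)
    where
    rec = count-nonneg 0≤φ E
    go : ∀ k → Dec (Loop s f) → 0ℤ ≤ count φ (f ∷ E) s k
    go k       (yes l) = subst (0ℤ ≤_) (sym (Θ-loop _ k l)) (rec s k)
    go zero    (no ¬l) = subst (0ℤ ≤_) (sym (Θ-zero _ ¬l)) (rec (s ∙ f) 0)
    go (suc k) (no ¬l) = subst (0ℤ ≤_) (sym (Θ-suc _ k ¬l)) (+-mono-≤ (rec s k) (rec (s ∙ f) (suc k)))

private
  ≤-*-mono : ∀ {p q r t} → 0ℤ ≤ p → 0ℤ ≤ r → p ≤ q → r ≤ t → p * r ≤ q * t
  ≤-*-mono {p} {q} {r} {t} 0≤p 0≤r p≤q r≤t = ≤-trans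
    (*-monoʳ-≤-nonNeg r {{nonNegative 0≤r}} p≤q)
    (*-monoˡ-≤-nonNeg q {{nonNegative (≤-trans 0≤p p≤q)}} r≤t)

limit : ∀ {y C p} → 0ℤ ≤ y → 0ℤ ≤ C → (∀ m → let T = + suc m in T * T * p ≤ (T * y + C) * (T * y + C)) →
  p ≤ y * y
-- At T = 1 + 2yC + C² the cross terms 2TyC + C² are smaller than T².
limit {+ y} {+ C} {p} _ _ bound = ≮⇒≥ λ y²<p → <-irrefl refl (begin-strict
    T * T * (1ℤ + + y * + y)
      ≤⟨ *-monoˡ-≤-nonNeg (T * T) {{nonNegative (0≤i*i T)}} (i<j⇒suc[i]≤j y²<p) ⟩
    T * T * p
      ≤⟨ bound m ⟩
    (T * + y + + C) * (T * + y + + C)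
      ≡⟨ expand T (+ y) (+ C) ⟩
    T * T * (+ y * + y) + (T * (+ y * + C + + y * + C) + 1ℤ * (+ C * + C))
      ≤⟨ +-monoʳ-≤ (T * T * (+ y * + y)) (+-monoʳ-≤ (T * (+ y * + C + + y * + C))
           (*-monoʳ-≤-nonNeg (+ C * + C) {{nonNegative (0≤i*i (+ C))}} (+≤+ (ℕ.s≤s (ℕ.z≤n {m}))))) ⟩
    T * T * (+ y * + y) + (T * (+ y * + C + + y * + C) + T * (+ C * + C))
      ≡⟨ cong (λ t → T * T * (+ y * + y) + t)
           (trans (sym (*-distribˡ-+ T (+ y * + C + + y * + C) (+ C * + C))) (cong (T *_) cast)) ⟩
    T * T * (+ y * + y) + T * + m
      <⟨ +-monoʳ-< (T * T * (+ y * + y)) (*-monoˡ-<-pos T (+<+ (ℕ.n<1+n m))) ⟩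
    T * T * (+ y * + y) + T * T
      ≡⟨ collect T (+ y) ⟩
    T * T * (1ℤ + + y * + y) ∎)
  where
  open ≤-Reasoning
  m = y ℕ.* C ℕ.+ y ℕ.* C ℕ.+ C ℕ.* C
  T : ℤ
  T = + suc m
  cast : + y * + C + + y * + C + + C * + C ≡ + m
  cast = sym (trans (pos-+ (y ℕ.* C ℕ.+ y ℕ.* C) (C ℕ.* C)) (cong₂ _+_
    (trans (pos-+ (y ℕ.* C) (y ℕ.* C)) (cong₂ _+_ (pos-* y C) (pos-* y C))) (pos-* C C)))
  expand : ∀ T y C → (T * y + C) * (T * y + C) ≡ T * T * (y * y) + (T * (y * C + y * C) + 1ℤ * (C * C))
  expand = solve-∀
  collect : ∀ T y → T * T * (y * y) + T * T ≡ T * T * (1ℤ + y * y)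
  collect = solve-∀

module Limit (n : ℕ) where
  open Calculus (graphic (suc n))
  open Lorentz (graphic (suc n))
  open Base (graphic (suc n))
  open Bounds (graphic (suc n))
  open Rank n

  -- Index 2 stands for degree 0: an intersection form involves three consecutive indices,
  -- and its first two entries have to vanish for the lowest one.
  peak : ℕ → ℤ
  peak 2 = 1ℤ
  peak _ = 0ℤ

  spanning : Fn
  spanning s k = indicator (top? s) * peak k

  spanning-resp : Resp spanning
  spanning-resp {s} {t} eq k = cong (λ i → i * peak k)
    (indicator-⇔ (top? s) (top? t) (Top-resp {s} {t} eq) (Top-resp {t} {s} (≈-sym {s} {t} eq)))

  0≤indicator : ∀ {P : Set} (d : Dec P) → 0ℤ ≤ indicator d
  0≤indicator (yes _) = +≤+ ℕ.z≤n
  0≤indicator (no _)  = ≤-refl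

  0≤spanning : ∀ s k → 0ℤ ≤ spanning s k
  0≤spanning s k = 0≤i*j (0≤indicator (top? s)) (0≤peak k)
    where
    0≤peak : ∀ k → 0ℤ ≤ peak k
    0≤peak 0 = ≤-refl
    0≤peak 1 = ≤-refl
    0≤peak 2 = +≤+ ℕ.z≤n
    0≤peak (suc (suc (suc _))) = ≤-refl

  -- A perturbation of T^(n+L) spanning that is positive for k ≥ 2.
  module Perturbation (m l : ℕ) where
    T L : ℕ
    T = suc m
    L = suc l

    ρ : State → ℤ
    ρ (_ , e) = + (T ℕ.^ e)

    ρ-∙ : ∀ s f → ¬ Loop s f → ρ (s ∙ f) ≡ + T * ρ s
    ρ-∙ (_ , e) _ _ = pos-* T (T ℕ.^ e)

    ρ-resp : ∀ s t → s ≈ t → ρ s ≡ ρ t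
    ρ-resp _ _ (_ , _ , e≡e′) = cong (λ e → + (T ℕ.^ e)) e≡e′

    -- The factor T^(- degree), multiplied by T^L to stay integral and cut off above degree L.
    U : ℕ → ℤ
    U 0             = 0ℤ
    U 1             = 0ℤ
    U (suc (suc k)) = + (T ℕ.^ (L ℕ.∸ k))

    perturbed : Fn
    perturbed = weight ρ (+ T) U ρ-∙

    perturbed-resp : Resp perturbed
    perturbed-resp = weight-resp ρ (+ T) U ρ-∙ ρ-resp

    perturbed-pos : ∀ s k → 0ℤ < perturbed s (2 ℕ.+ k)
    perturbed-pos (_ , e) k = 0<i*j (+<+ (ℕ.m^n>0 T e)) (+<+ (ℕ.m^n>0 T (L ℕ.∸ k)))

    0≤U : ∀ k → 0ℤ ≤ U k
    0≤U 0             = ≤-refl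
    0≤U 1             = ≤-refl
    0≤U (suc (suc k)) = +≤+ ℕ.z≤n

    -- From index 2 on the sequence is geometric up to index 2 + L, which gives equality. At the
    -- cutoff it reads T, 1, 1, which fails for T > 1; hence the bound on k carried through the
    -- Hodge statements.
    U-log-concave : ∀ {k} → k ℕ.≤ L → U k * U (2 ℕ.+ k) ≤ U (1 ℕ.+ k) * U (1 ℕ.+ k)
    U-log-concave {0}           _   = +≤+ ℕ.z≤n
    U-log-concave {1}           _   = 0≤i*i (U 2)
    U-log-concave {suc (suc k)} k≤L = ≤-reflexive (begin
      + (T ℕ.^ (L ℕ.∸ k)) * + (T ℕ.^ q)
        ≡⟨ cong (λ e → + (T ℕ.^ e) * + (T ℕ.^ q)) (trans (∸-step (ℕ.<⇒≤ k≤L)) (cong suc (∸-step k≤L))) ⟩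
      + (T ℕ.* (T ℕ.* T ℕ.^ q)) * + (T ℕ.^ q)
        ≡⟨ cong (λ t → t * + (T ℕ.^ q)) (trans (pos-* T (T ℕ.* T ℕ.^ q)) (cong (+ T *_) (pos-* T (T ℕ.^ q)))) ⟩
      + T * (+ T * + (T ℕ.^ q)) * + (T ℕ.^ q)
        ≡⟨ lemma (+ T) (+ (T ℕ.^ q)) ⟩
      + T * + (T ℕ.^ q) * (+ T * + (T ℕ.^ q))
        ≡⟨ cong (λ t → t * t) (pos-* T (T ℕ.^ q)) ⟨
      + (T ℕ.^ suc q) * + (T ℕ.^ suc q)
        ≡⟨ cong (λ e → + (T ℕ.^ e) * + (T ℕ.^ e)) (∸-step k≤L) ⟨
      + (T ℕ.^ (L ℕ.∸ suc k)) * + (T ℕ.^ (L ℕ.∸ suc k)) ∎)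
      where
      open ≡-Reasoning
      q = L ℕ.∸ suc (suc k)
      ∸-step : ∀ {j} → suc j ℕ.≤ L → L ℕ.∸ j ≡ suc (L ℕ.∸ suc j)
      ∸-step le = ℕ.+-∸-assoc 1 le
      lemma : ∀ t p → t * (t * p) * p ≡ t * p * (t * p)
      lemma = solve-∀

    hodge-perturbed : ∀ E {k} → k ℕ.≤ L → HodgeIndex (count perturbed E) k
    hodge-perturbed E = hodge-count E L (λ {s} {t} → perturbed-resp {s} {t})
      (λ s → *-zeroʳ (ρ s)) (λ s → *-zeroʳ (ρ s)) perturbed-pos
      λ {k} k≤L → hodge-weight ρ (+ T) U ρ-∙ ρ-resp
        (+≤+ (ℕ.s≤s ℕ.z≤n)) k (0≤U (1 ℕ.+ k)) (0≤U (2 ℕ.+ k)) (U-log-concave k≤L)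

    -- The second largest power in play. Spanning flats in degree 0 have the value T^(n + L) = T
    -- `scale`; every other value at a ranked state is at most `scale`.
    scale : ℤ
    scale = + (T ℕ.^ (n ℕ.+ l))

    power-merge : ∀ e j → + (T ℕ.^ e) * + (T ℕ.^ j) ≡ + (T ℕ.^ (e ℕ.+ j))
    power-merge e j = trans (sym (pos-* (T ℕ.^ e) (T ℕ.^ j))) (cong +_ (sym (ℕ.^-distribˡ-+-* T e j)))

    power≤scale : ∀ e j → e ℕ.+ j ℕ.≤ n ℕ.+ l → + (T ℕ.^ e) * + (T ℕ.^ j) ≤ scale
    power≤scale e j le = subst (_≤ scale) (sym (power-merge e j)) (+≤+ (ℕ.^-monoʳ-≤ T le))

    power-top : + (T ℕ.^ n) * + (T ℕ.^ L) ≡ + T * scale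
    power-top = trans (power-merge n L)
      (trans (cong (λ e → + (T ℕ.^ e)) (ℕ.+-suc n l)) (pos-* T (T ℕ.^ (n ℕ.+ l))))

    0≤scale : 0ℤ ≤ scale
    0≤scale = +≤+ ℕ.z≤n

    -- The summand `0ℤ`, like `scale * 1ℤ + 0ℤ` in `upper`, gives the bound the shape w φ + ψ that
    -- `count-linear` takes apart.
    lower : ∀ {s} → Ranked s → ∀ k → + T * scale * spanning s k + 0ℤ ≤ perturbed s k
    lower {s , e} R k = go k (top? (s , e)) refl
      where
      go : ∀ k d → d ≡ top? (s , e) → + T * scale * (indicator d * peak k) + 0ℤ ≤ perturbed (s , e) k
      go 0 d _ = ≤-reflexive (zeros (+ T * scale) (indicator d) (ρ (s , e)))
        where
        zeros : ∀ t i r → t * (i * 0ℤ) + 0ℤ ≡ r * 0ℤ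
        zeros = solve-∀
      go 1 d _ = ≤-reflexive (zeros (+ T * scale) (indicator d) (ρ (s , e)))
        where
        zeros : ∀ t i r → t * (i * 0ℤ) + 0ℤ ≡ r * 0ℤ
        zeros = solve-∀
      go 2 (yes top) _ = ≤-reflexive (trans (unit (+ T * scale)) (trans (sym power-top)
        (cong (λ e → + (T ℕ.^ e) * + (T ℕ.^ L)) (sym (rank-top R top)))))
        where
        unit : ∀ t → t * (1ℤ * 1ℤ) + 0ℤ ≡ t
        unit = solve-∀
      go 2 (no _) _ = subst (_≤ perturbed (s , e) 2) (zeros (+ T * scale)) (<⇒≤ (perturbed-pos (s , e) 0))
        where
        zeros : ∀ t → 0ℤ ≡ t * (0ℤ * 1ℤ) + 0ℤ
        zeros = solve-∀
      go (suc (suc (suc k))) d _ = subst (_≤ perturbed (s , e) (3 ℕ.+ k)) (zeros (+ T * scale) (indicator d))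
        (<⇒≤ (perturbed-pos (s , e) (suc k)))
        where
        zeros : ∀ t i → 0ℤ ≡ t * (i * 0ℤ) + 0ℤ
        zeros = solve-∀

    upper : ∀ {s} → Ranked s → ∀ k → perturbed s k ≤ + T * scale * spanning s k + (scale * 1ℤ + 0ℤ)
    upper {s , e} R k = go k (top? (s , e))
      where
      zeros : ∀ t i p → p ≡ t * (i * 0ℤ) + (p * 1ℤ + 0ℤ)
      zeros = solve-∀
      rank≤n : Dec (Top (s , e)) → e ℕ.≤ n
      rank≤n (yes top) = ℕ.≤-reflexive (rank-top R top)
      rank≤n (no ¬top) = ℕ.<⇒≤ (rank-¬top R ¬top)
      go : ∀ k d → perturbed (s , e) k ≤ + T * scale * (indicator d * peak k) + (scale * 1ℤ + 0ℤ)
      go 0 d = subst₂ _≤_ (sym (*-zeroʳ (ρ (s , e)))) (zeros (+ T * scale) (indicator d) scale) 0≤scale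
      go 1 d = subst₂ _≤_ (sym (*-zeroʳ (ρ (s , e)))) (zeros (+ T * scale) (indicator d) scale) 0≤scale
      go 2 (yes top) = subst₂ _≤_
        (trans (sym power-top) (cong (λ e → + (T ℕ.^ e) * + (T ℕ.^ L)) (sym (rank-top R top))))
        (unit (+ T * scale) scale) (i≤j+i′ (+ T * scale) 0≤scale)
        where
        unit : ∀ t p → t + p ≡ t * (1ℤ * 1ℤ) + (p * 1ℤ + 0ℤ)
        unit = solve-∀
        i≤j+i′ : ∀ t {p} → 0ℤ ≤ p → t ≤ t + p
        i≤j+i′ t {p} 0≤p = subst (_≤ t + p) (+-identityʳ t) (+-monoʳ-≤ t 0≤p)
      go 2 (no ¬top) = subst (perturbed (s , e) 2 ≤_) (drop (+ T * scale) scale)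
        (power≤scale e L (subst (ℕ._≤ n ℕ.+ l) (sym (ℕ.+-suc e l)) (ℕ.+-monoˡ-≤ l (rank-¬top R ¬top))))
        where
        drop : ∀ t p → p ≡ t * (0ℤ * 1ℤ) + (p * 1ℤ + 0ℤ)
        drop = solve-∀
      go (suc (suc (suc k))) d = subst (perturbed (s , e) (3 ℕ.+ k) ≤_)
        (zeros (+ T * scale) (indicator d) scale)
        (power≤scale e (l ℕ.∸ k) (ℕ.+-mono-≤ (rank≤n (top? (s , e))) (ℕ.m∸n≤m l k)))

    count-lower : ∀ E {s} → Ranked s → ∀ k → + T * scale * count spanning E s k ≤ count perturbed E s k
    count-lower E {s} R k = begin
      + T * scale * count spanning E s k
        ≡⟨ +-identityʳ (+ T * scale * count spanning E s k) ⟨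
      + T * scale * count spanning E s k + 0ℤ
        ≤⟨ +-monoʳ-≤ (+ T * scale * count spanning E s k) (count-nonneg (λ _ _ → ≤-refl) E s k) ⟩
      + T * scale * count spanning E s k + count (λ _ _ → 0ℤ) E s k
        ≡⟨ count-linear (+ T * scale) spanning (λ _ _ → 0ℤ) E s k ⟨
      count (λ s k → + T * scale * spanning s k + 0ℤ) E s k
        ≤⟨ count-mono {Ranked} Ranked-∙ lower E R k ⟩
      count perturbed E s k ∎
      where open ≤-Reasoning

    count-upper : ∀ E {s} → Ranked s → ∀ k → count perturbed E s k
      ≤ + T * scale * count spanning E s k + scale * count (λ _ _ → 1ℤ) E s k
    count-upper E {s} R k = begin
      count perturbed E s k
        ≤⟨ count-mono {Ranked} Ranked-∙ upper E R k ⟩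
      count (λ s k → + T * scale * spanning s k + (scale * 1ℤ + 0ℤ)) E s k
        ≡⟨ count-linear (+ T * scale) spanning (λ _ _ → scale * 1ℤ + 0ℤ) E s k ⟩
      + T * scale * count spanning E s k + count (λ _ _ → scale * 1ℤ + 0ℤ) E s k
        ≡⟨ cong (λ t → + T * scale * count spanning E s k + t)
             (trans (count-linear scale (λ _ _ → 1ℤ) (λ _ _ → 0ℤ) E s k)
               (trans (cong (λ t → scale * count (λ _ _ → 1ℤ) E s k + t) (count-null E s k)) (+-identityʳ _))) ⟩
      + T * scale * count spanning E s k + scale * count (λ _ _ → 1ℤ) E s k ∎
      where open ≤-Reasoning

  -- Divided by `scale`², log-concavity of the perturbed numbers reads T² x z ≤ (T y + C)². The
  -- error C counts from the constant function 1 and is independent of T, so T may tend to infinity.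
  log-concave-spanning : ∀ E {s} → Ranked s → ∀ k →
    count spanning E s k * count spanning E s (2 ℕ.+ k) ≤ count spanning E s (1 ℕ.+ k) * count spanning E s (1 ℕ.+ k)
  log-concave-spanning E {s} R k = limit {y} {C} (0≤c _) (count-nonneg (λ _ _ → +≤+ ℕ.z≤n) E s (1 ℕ.+ k)) bound
    where
    x y z C : ℤ
    x = count spanning E s k
    y = count spanning E s (1 ℕ.+ k)
    z = count spanning E s (2 ℕ.+ k)
    C = count (λ _ _ → 1ℤ) E s (1 ℕ.+ k)
    0≤c : ∀ k → 0ℤ ≤ count spanning E s k
    0≤c = count-nonneg 0≤spanning E s
    bound : ∀ m → + suc m * + suc m * (x * z) ≤ (+ suc m * y + C) * (+ suc m * y + C)
    bound m = *-cancelˡ-≤-pos _ _ (scale * scale) {{positive (0<i*j 0<scale 0<scale)}} (begin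
      scale * scale * (+ T * + T * (x * z))
        ≡⟨ lemma₁ scale (+ T) x z ⟩
      + T * scale * x * (+ T * scale * z)
        ≤⟨ ≤-*-mono (0≤i*j 0≤Tp (0≤c k)) (0≤i*j 0≤Tp (0≤c (2 ℕ.+ k)))
             (count-lower E R k) (count-lower E R (2 ℕ.+ k)) ⟩
      count perturbed E s k * count perturbed E s (2 ℕ.+ k)
        ≤⟨ log-concave-count (hodge-perturbed E (ℕ.n≤1+n k)) s ⟩
      count perturbed E s (1 ℕ.+ k) * count perturbed E s (1 ℕ.+ k)
        ≤⟨ ≤-*-mono 0≤d 0≤d (count-upper E R (1 ℕ.+ k)) (count-upper E R (1 ℕ.+ k)) ⟩
      (+ T * scale * y + scale * C) * (+ T * scale * y + scale * C)
        ≡⟨ lemma₂ scale (+ T) y C ⟩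
      scale * scale * ((+ T * y + C) * (+ T * y + C)) ∎)
      where
      open ≤-Reasoning
      -- Cutoff L = k + 1, so that level k is within range, and T = m + 1.
      open Perturbation m k
      0<scale : 0ℤ < scale
      0<scale = +<+ (ℕ.m^n>0 T (n ℕ.+ k))
      0≤Tp : 0ℤ ≤ + T * scale
      0≤Tp = 0≤i*j {+ T} {scale} (+≤+ ℕ.z≤n) 0≤scale
      0≤d : 0ℤ ≤ count perturbed E s (1 ℕ.+ k)
      0≤d = ≤-trans (0≤i*j 0≤Tp (0≤c (1 ℕ.+ k))) (count-lower E R (1 ℕ.+ k))
      lemma₁ : ∀ p t x z → p * p * (t * t * (x * z)) ≡ t * p * x * (t * p * z)
      lemma₁ = solve-∀
      lemma₂ : ∀ p t y C → (t * p * y + p * C) * (t * p * y + p * C) ≡ p * p * ((t * y + C) * (t * y + C))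
      lemma₂ = solve-∀

-- Parking functions

when : ∀ {P : Set} → Dec P → ℕ → ℕ
when d a = if does d then a else 0

when-yes : ∀ {P : Set} (d : Dec P) {a} → P → when d a ≡ a
when-yes (yes _) p = refl
when-yes (no ¬p) p = contradiction p ¬p

when-no : ∀ {P : Set} (d : Dec P) {a} → ¬ P → when d a ≡ 0
when-no (yes p) ¬p = contradiction p ¬p
when-no (no _)  ¬p = refl

Edge : ℕ → Set
Edge N = Fin N × Fin N

module _ {N : ℕ} where

  out : Subset N → Fin N → ℕ
  out J w = if lookup J w then 0 else 1

  link : Subset N → Fin N → Edge N → ℕ
  link J x (u , v) = when (x ≟ᶠ u) (out J v) ℕ.+ when (x ≟ᶠ v) (out J u)

  outdegree : List (Edge N) → Subset N → Fin N → ℕ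
  outdegree E J x = sum (map (link J x) E)

-- Multigraphs as edge lists

star : ∀ {N} → (Fin N → ℕ) → List (Fin N)
star {zero}  f = []
star {suc N} f = replicate (f zero) zero ++ map suc (star (f ∘ suc))

edges : ∀ {N} → (Fin N → Fin N → ℕ) → List (Edge N)
edges {zero}  m = []
edges {suc N} m = map (λ w → zero , suc w) (star (m zero ∘ suc))
               ++ map (λ (u , v) → suc u , suc v) (edges (λ u v → m (suc u) (suc v)))

sum-replicate : ∀ {A : Set} (g : A → ℕ) k x → sum (map g (replicate k x)) ≡ k ℕ.* g x
sum-replicate g zero    x = refl
sum-replicate g (suc k) x = cong (g x ℕ.+_) (sum-replicate g k x)

sum-star : ∀ {N} (g f : Fin N → ℕ) → sum (map g (star f)) ≡ Vec.sum (tabulate λ w → f w ℕ.* g w)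
sum-star {zero}  g f = refl
sum-star {suc N} g f = begin
  sum (map g (replicate (f zero) zero ++ map suc (star (f ∘ suc))))
    ≡⟨ cong sum (map-++ g (replicate (f zero) zero) _) ⟩
  sum (map g (replicate (f zero) zero) ++ map g (map suc (star (f ∘ suc))))
    ≡⟨ sum-++ (map g (replicate (f zero) zero)) _ ⟩
  sum (map g (replicate (f zero) zero)) ℕ.+ sum (map g (map suc (star (f ∘ suc))))
    ≡⟨ cong₂ ℕ._+_ (sum-replicate g (f zero) zero)
         (trans (cong sum (sym (map-∘ (star (f ∘ suc))))) (sum-star (g ∘ suc) (f ∘ suc))) ⟩
  f zero ℕ.* g zero ℕ.+ Vec.sum (tabulate λ w → f (suc w) ℕ.* g (suc w)) ∎
  where open ≡-Reasoning

sum-tabulate-0 : ∀ {N} (f : Fin N → ℕ) → (∀ w → f w ≡ 0) → Vec.sum (tabulate f) ≡ 0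
sum-tabulate-0 {zero}  f f0 = refl
sum-tabulate-0 {suc N} f f0 = cong₂ ℕ._+_ (f0 zero) (sum-tabulate-0 (f ∘ suc) (f0 ∘ suc))

sum-tabulate-cong : ∀ {N} {f g : Fin N → ℕ} → (∀ w → f w ≡ g w) →
  Vec.sum (tabulate f) ≡ Vec.sum (tabulate g)
sum-tabulate-cong {zero}  eq = refl
sum-tabulate-cong {suc N} eq = cong₂ ℕ._+_ (eq zero) (sum-tabulate-cong (eq ∘ suc))

sum-tabulate-single : ∀ {N} (f : Fin N → ℕ) y c →
  Vec.sum (tabulate λ w → f w ℕ.* when (y ≟ᶠ w) c) ≡ f y ℕ.* c
sum-tabulate-single {suc N} f zero c = trans
  (cong (f zero ℕ.* c ℕ.+_) (sum-tabulate-0 _ (λ w → ℕ.*-zeroʳ (f (suc w))))) (ℕ.+-identityʳ _)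
sum-tabulate-single {suc N} f (suc y) c =
  cong₂ ℕ._+_ (ℕ.*-zeroʳ (f zero)) (sum-tabulate-single (f ∘ suc) y c)

*-out : ∀ {N} m (J : Subset N) w → m ℕ.* out J w ≡ (if lookup J w then 0 else m)
*-out m J w with lookup J w
... | true  = ℕ.*-zeroʳ m
... | false = ℕ.*-identityʳ m

sum-shifted : ∀ {N} (g : Edge (suc N) → ℕ) (E : List (Edge N)) →
  sum (map g (map (λ (u , v) → suc u , suc v) E)) ≡ sum (map (λ (u , v) → g (suc u , suc v)) E)
sum-shifted g E = cong sum (sym (map-∘ E))

-- Vertex 0 is split off, its edges forming a star; x may then be 0 or not, so the claim is made for
-- every vertex and every J. Each edge is listed once, smaller end first, and the symmetry of m
-- serves the other end.
outdegree-edges : ∀ {N} (m : Fin N → Fin N → ℕ) → (∀ u v → m u v ≡ m v u) → (∀ v → m v v ≡ 0) →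
  ∀ J x → outdegree (edges m) J x ≡ Vec.sum (tabulate λ w → if lookup J w then 0 else m x w)
outdegree-edges {suc N} m m-sym m-diag (b ∷ J) x = begin
  sum (map (link (b ∷ J) x) (edges m))
    ≡⟨ cong sum (map-++ (link (b ∷ J) x) (map (λ w → zero , suc w) (star (m zero ∘ suc))) _) ⟩
  sum (map (link (b ∷ J) x) (map (λ w → zero , suc w) (star (m zero ∘ suc))) ++ _)
    ≡⟨ sum-++ (map (link (b ∷ J) x) (map (λ w → zero , suc w) (star (m zero ∘ suc)))) _ ⟩
  sum (map (link (b ∷ J) x) (map (λ w → zero , suc w) (star (m zero ∘ suc))))
    ℕ.+ sum (map (link (b ∷ J) x) (map (λ (u , v) → suc u , suc v) (edges m′)))
    ≡⟨ cong₂ ℕ._+_ (trans (cong sum (sym (map-∘ (star (m zero ∘ suc)))))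
                          (sum-star (λ w → link (b ∷ J) x (zero , suc w)) (m zero ∘ suc)))
                   (sum-shifted (link (b ∷ J) x) (edges m′)) ⟩
  Vec.sum (tabulate λ w → m zero (suc w) ℕ.* link (b ∷ J) x (zero , suc w))
    ℕ.+ sum (map (λ (u , v) → link (b ∷ J) x (suc u , suc v)) (edges m′))
    ≡⟨ split x ⟩
  Vec.sum (tabulate λ w → if lookup (b ∷ J) w then 0 else m x w) ∎
  where
  open ≡-Reasoning
  m′ : Fin N → Fin N → ℕ
  m′ u v = m (suc u) (suc v)
  vanish : ∀ (E : List (Edge N)) → sum (map (λ _ → 0) E) ≡ 0
  vanish []      = refl
  vanish (_ ∷ E) = vanish E
  split : ∀ x → Vec.sum (tabulate λ w → m zero (suc w) ℕ.* link (b ∷ J) x (zero , suc w))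
      ℕ.+ sum (map (λ (u , v) → link (b ∷ J) x (suc u , suc v)) (edges m′))
    ≡ Vec.sum (tabulate λ w → if lookup (b ∷ J) w then 0 else m x w)
  split zero = begin
    Vec.sum (tabulate λ w → m zero (suc w) ℕ.* (out J w ℕ.+ 0)) ℕ.+ sum (map (λ _ → 0) (edges m′))
      ≡⟨ cong₂ ℕ._+_ (sum-tabulate-cong λ w → trans (cong (m zero (suc w) ℕ.*_) (ℕ.+-identityʳ _))
           (*-out (m zero (suc w)) J w)) (vanish (edges m′)) ⟩
    Vec.sum (tabulate λ w → if lookup J w then 0 else m zero (suc w)) ℕ.+ 0
      ≡⟨ ℕ.+-comm _ 0 ⟩
    0 ℕ.+ Vec.sum (tabulate λ w → if lookup J w then 0 else m zero (suc w))
      ≡⟨ cong (ℕ._+ _) (diagonal b) ⟨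
    (if b then 0 else m zero zero) ℕ.+ Vec.sum (tabulate λ w → if lookup J w then 0 else m zero (suc w)) ∎
    where
    diagonal : ∀ b → (if b then 0 else m zero zero) ≡ 0
    diagonal true  = refl
    diagonal false = m-diag zero
  split (suc y) = cong₂ ℕ._+_
    (trans (sum-tabulate-single (m zero ∘ suc) y (out (b ∷ J) zero))
      (trans (cong (ℕ._* out (b ∷ J) zero) (m-sym zero (suc y))) (*-out (m (suc y) zero) (b ∷ J) zero)))
    (outdegree-edges m′ (λ u v → m-sym (suc u) (suc v)) (λ v → m-diag (suc v)) J y)

outdegree-shift : ∀ {N} (E₁ : List (Edge N)) e E₂ J x →
  outdegree (E₁ ++ e ∷ E₂) J x ≡ link J x e ℕ.+ outdegree (E₁ ++ E₂) J x
outdegree-shift E₁ e E₂ J x = begin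
  sum (map (link J x) (E₁ ++ e ∷ E₂))
    ≡⟨ trans (cong sum (map-++ (link J x) E₁ _)) (sum-++ (map (link J x) E₁) _) ⟩
  sum (map (link J x) E₁) ℕ.+ (link J x e ℕ.+ sum (map (link J x) E₂))
    ≡⟨ x∙yz≈y∙xz (sum (map (link J x) E₁)) (link J x e) _ ⟩
  link J x e ℕ.+ (sum (map (link J x) E₁) ℕ.+ sum (map (link J x) E₂))
    ≡⟨ cong (link J x e ℕ.+_)
         (trans (cong sum (map-++ (link J x) E₁ _)) (sum-++ (map (link J x) E₁) _)) ⟨
  link J x e ℕ.+ sum (map (link J x) (E₁ ++ E₂)) ∎
  where
  open ≡-Reasoning

-- Deletion and contraction of an edge at the root

module Parking {n : ℕ} where

  Root : Labelling {suc n} → Fin (suc n) → Set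
  Root s w = s w ≡ s zero

  root? : ∀ s w → Dec (Root s w)
  root? s w = s w ≟ᶠ s zero

  -- Preserved because only edges leaving the root block get contracted: every other block remains a
  -- single vertex, which keeps its own value in the vector.
  Simple : Labelling {suc n} → Set
  Simple s = ∀ {w x} → s w ≡ s x → Root s w ⊎ w ≡ x

  -- G-parking functions after contraction of the block of the root; the absorbed vertices
  -- keep the value 1, so that a value 1 at i becomes the condition that i is absorbed.
  record Parks (s : Labelling {suc n}) (E : List (Edge (suc n))) (a : Vec ℕ n) : Set where
    constructor parks
    field
      atLeast1 : ∀ i → 1 ℕ.≤ lookup a i
      absorbed : ∀ i → Root s (suc i) → lookup a i ≡ 1
      park     : ∀ (I : Subset n) → Nonempty I → (∀ {i} → i ∈ I → ¬ Root s (suc i)) →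
        ∃ λ i → i ∈ I × lookup a i ℕ.≤ outdegree E (outside ∷ I) (suc i)

  module Absorb {s : Labelling {suc n}} (simple : Simple s) {r i₀}
                (root : Root s r) (¬root : ¬ Root s (suc i₀)) where

    v : Fin (suc n)
    v = suc i₀

    private
      absorbed? : ∀ w → Dec (Root s w ⊎ w ≡ v)
      absorbed? w = root? s w ⊎-dec (w ≟ᶠ v)

      shade : ∀ {w} → Dec (Root s w ⊎ w ≡ v) → Fin (suc n)
      shade     (yes _) = zero
      shade {w} (no _)  = w

      -- The partition expected once v has joined the root block. A least labelling t that joins r
      -- and v lies below χ, which bounds the new root block from above.
      χ : Labelling {suc n}
      χ w = shade (absorbed? w)

      χ-yes : ∀ {w} → Root s w ⊎ w ≡ v → χ w ≡ zero
      χ-yes {w} p with absorbed? w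
      ... | yes _ = refl
      ... | no ¬p = contradiction p ¬p

      χ-no : ∀ {w} → ¬ (Root s w ⊎ w ≡ v) → χ w ≡ w
      χ-no {w} ¬p with absorbed? w
      ... | yes p = contradiction p ¬p
      ... | no _  = refl

      s⊑χ : s ⊑ χ
      s⊑χ {w} {x} eq with simple eq
      ... | inj₁ p    = trans (χ-yes (inj₁ p)) (sym (χ-yes (inj₁ (trans (sym eq) p))))
      ... | inj₂ refl = refl

    module _ {t : Labelling {suc n}} (s⊑t : s ⊑ t) (joins : t r ≡ t v)
             (least : ∀ {χ : Labelling {suc n}} → s ⊑ χ → χ r ≡ χ v → t ⊑ χ) where

      private
        t⊑χ : t ⊑ χ
        t⊑χ = least (λ {w} {x} → s⊑χ {w} {x}) (trans (χ-yes (inj₁ root)) (sym (χ-yes (inj₂ refl))))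

      Root⇒ : ∀ {w} → Root t w → Root s w ⊎ w ≡ v
      Root⇒ {w} p with absorbed? w
      ... | yes q = q
      ... | no ¬q = contradiction
        (inj₁ (cong s (trans (sym (χ-no ¬q)) (trans (t⊑χ p) (χ-yes (inj₁ refl)))))) ¬q

      Root⇐ : ∀ {w} → Root s w ⊎ w ≡ v → Root t w
      Root⇐ (inj₁ p)    = s⊑t p
      Root⇐ (inj₂ refl) = trans (sym joins) (s⊑t root)

      Simple-absorb : Simple t
      Simple-absorb {w} {x} eq with absorbed? w | absorbed? x
      ... | yes p | _     = inj₁ (Root⇐ p)
      ... | no ¬p | yes q = contradiction
        (inj₁ (cong s (trans (sym (χ-no ¬p)) (trans (t⊑χ eq) (χ-yes q))))) ¬p
      ... | no ¬p | no ¬q = inj₂ (trans (sym (χ-no ¬p)) (trans (t⊑χ eq) (χ-no ¬q)))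

      module Step {E E′ : List (Edge (suc n))} {e}
        (E-e : ∀ J x → outdegree E J x ≡ link J x e ℕ.+ outdegree E′ J x)
        (e≡  : e ≡ (r , v) ⊎ e ≡ (v , r)) where

        private
          r-outside : ∀ (I : Subset n) → (∀ {i} → i ∈ I → ¬ Root s (suc i)) → out (outside ∷ I) r ≡ 1
          r-outside I free = go r root
            where
            go : ∀ w → Root s w → out (outside ∷ I) w ≡ 1
            go zero    p = refl
            go (suc i) p with lookup I i in eq
            ... | true  = contradiction p (free (lookup⇒[]= i I eq))
            ... | false = refl

          module _ (I : Subset n) (free : ∀ {i} → i ∈ I → ¬ Root s (suc i)) {i} (i∈I : i ∈ I) where

            suci≢r : suc i ≢ r
            suci≢r refl = free i∈I root

            link-r : link (outside ∷ I) (suc i) e ≡ when (suc i ≟ᶠ v) 1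
            link-r = [ (λ { refl → cong₂ ℕ._+_ r-side v-side })
                     , (λ { refl → trans (cong₂ ℕ._+_ v-side r-side) (ℕ.+-identityʳ _) })
                     ]′ e≡
              where
              r-side : when (suc i ≟ᶠ r) (out (outside ∷ I) v) ≡ 0
              r-side = when-no (suc i ≟ᶠ r) suci≢r
              v-side : when (suc i ≟ᶠ v) (out (outside ∷ I) r) ≡ when (suc i ≟ᶠ v) 1
              v-side = cong (when (suc i ≟ᶠ v)) (r-outside I free)

            degree-v : i ≡ i₀ → outdegree E (outside ∷ I) (suc i) ≡ suc (outdegree E′ (outside ∷ I) (suc i))
            degree-v eq = trans (E-e (outside ∷ I) (suc i)) (cong (ℕ._+ outdegree E′ (outside ∷ I) (suc i))
              (trans link-r (when-yes (suc i ≟ᶠ v) (cong suc eq))))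

            degree-other : i ≢ i₀ → outdegree E (outside ∷ I) (suc i) ≡ outdegree E′ (outside ∷ I) (suc i)
            degree-other neq = trans (E-e (outside ∷ I) (suc i)) (cong (ℕ._+ outdegree E′ (outside ∷ I) (suc i))
              (trans link-r (when-no (suc i ≟ᶠ v) (neq ∘ suc-injective))))

        -- The value 1 is the one prescribed for absorbed vertices, and a set avoiding the new root
        -- block does not contain i₀, so the removed edge contributes nothing to its outdegrees.
        contract⇒ : ∀ {a} → Parks s E a → lookup a i₀ ≡ 1 → Parks t E′ a
        contract⇒ {a} (parks pos one park) a≡1 = parks pos one′ park′
          where
          one′ : ∀ i → Root t (suc i) → lookup a i ≡ 1
          one′ i p = [ one i , (λ eq → trans (cong (lookup a) (suc-injective eq)) a≡1) ]′ (Root⇒ p)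
          park′ : ∀ I → Nonempty I → (∀ {i} → i ∈ I → ¬ Root t (suc i)) →
            ∃ λ i → i ∈ I × lookup a i ℕ.≤ outdegree E′ (outside ∷ I) (suc i)
          park′ I ne free = let i , i∈I , le = park I ne (λ i∈I p → free i∈I (Root⇐ (inj₁ p))) in
            i , i∈I , subst (lookup a i ℕ.≤_)
              (degree-other I (λ i∈I p → free i∈I (Root⇐ (inj₁ p))) i∈I
                (λ eq → free i∈I (Root⇐ (inj₂ (cong suc eq))))) le

        -- A set containing i₀ has i₀ itself as witness: its value is 1, and the edge e to the root
        -- block alone gives outdegree 1. Any other admissible set also avoids the enlarged root
        -- block.
        contract⇐ : ∀ {a} → Parks t E′ a → Parks s E a
        contract⇐ {a} (parks pos one park) = parks pos (λ i p → one i (Root⇐ (inj₁ p))) park′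
          where
          park′ : ∀ I → Nonempty I → (∀ {i} → i ∈ I → ¬ Root s (suc i)) →
            ∃ λ i → i ∈ I × lookup a i ℕ.≤ outdegree E (outside ∷ I) (suc i)
          park′ I ne free with i₀ ∈? I
          ... | yes i₀∈I = i₀ , i₀∈I , ℕ.≤-trans (ℕ.≤-reflexive (one i₀ (Root⇐ (inj₂ refl))))
            (subst (1 ℕ.≤_) (sym (degree-v I free i₀∈I refl)) (ℕ.s≤s ℕ.z≤n))
          ... | no i₀∉I = i , i∈I , subst (lookup a i ℕ.≤_)
              (sym (degree-other I free i∈I λ eq → i₀∉I (subst (_∈ I) eq i∈I))) le
            where
            free′ : ∀ {i} → i ∈ I → ¬ Root t (suc i)
            free′ i∈I p = [ free i∈I , (λ eq → i₀∉I (subst (_∈ I) (suc-injective eq) i∈I)) ]′ (Root⇒ p)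
            i   = proj₁ (park I ne free′)
            i∈I = proj₁ (proj₂ (park I ne free′))
            le  = proj₂ (proj₂ (park I ne free′))

        -- At i₀ the value and the outdegree rise together by 1, and elsewhere both are unchanged,
        -- so each set keeps its witness.
        delete⇐ : ∀ {b} → Parks s E′ b → Parks s E (updateAt b i₀ suc)
        delete⇐ {b} (parks pos one park) = parks pos′ one′ park′
          where
          a = updateAt b i₀ suc
          same : ∀ {i} → i ≢ i₀ → lookup a i ≡ lookup b i
          same {i} neq = lookup∘updateAt′ i i₀ neq b
          pos′ : ∀ i → 1 ℕ.≤ lookup a i
          pos′ i with i ≟ᶠ i₀
          ... | yes refl = subst (1 ℕ.≤_) (sym (lookup∘updateAt i₀ b)) (ℕ.s≤s ℕ.z≤n)
          ... | no neq   = subst (1 ℕ.≤_) (sym (same neq)) (pos i)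
          one′ : ∀ i → Root s (suc i) → lookup a i ≡ 1
          one′ i p = trans (same (λ { refl → ¬root p })) (one i p)
          park′ : ∀ I → Nonempty I → (∀ {i} → i ∈ I → ¬ Root s (suc i)) →
            ∃ λ i → i ∈ I × lookup a i ℕ.≤ outdegree E (outside ∷ I) (suc i)
          park′ I ne free = let i , i∈I , le = park I ne free in i , i∈I , bound i∈I (i ≟ᶠ i₀) le
            where
            bound : ∀ {i} → i ∈ I → Dec (i ≡ i₀) → lookup b i ℕ.≤ outdegree E′ (outside ∷ I) (suc i) →
              lookup a i ℕ.≤ outdegree E (outside ∷ I) (suc i)
            bound i∈I (yes refl) le = subst₂ ℕ._≤_ (sym (lookup∘updateAt i₀ b))
              (sym (degree-v I free i∈I refl)) (ℕ.s≤s le)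
            bound i∈I (no neq)   le =
              subst₂ ℕ._≤_ (sym (same neq)) (sym (degree-other I free i∈I neq)) le

        delete⇒ : ∀ {b} → Parks s E (updateAt b i₀ suc) → 1 ℕ.≤ lookup b i₀ → Parks s E′ b
        delete⇒ {b} (parks pos one park) 1≤b = parks pos′ one′ park′
          where
          a = updateAt b i₀ suc
          same : ∀ {i} → i ≢ i₀ → lookup a i ≡ lookup b i
          same {i} neq = lookup∘updateAt′ i i₀ neq b
          pos′ : ∀ i → 1 ℕ.≤ lookup b i
          pos′ i with i ≟ᶠ i₀
          ... | yes refl = 1≤b
          ... | no neq   = subst (1 ℕ.≤_) (same neq) (pos i)
          one′ : ∀ i → Root s (suc i) → lookup b i ≡ 1
          one′ i p = trans (sym (same (λ { refl → ¬root p }))) (one i p)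
          park′ : ∀ I → Nonempty I → (∀ {i} → i ∈ I → ¬ Root s (suc i)) →
            ∃ λ i → i ∈ I × lookup b i ℕ.≤ outdegree E′ (outside ∷ I) (suc i)
          park′ I ne free = let i , i∈I , le = park I ne free in i , i∈I , bound i∈I (i ≟ᶠ i₀) le
            where
            bound : ∀ {i} → i ∈ I → Dec (i ≡ i₀) → lookup a i ℕ.≤ outdegree E (outside ∷ I) (suc i) →
              lookup b i ℕ.≤ outdegree E′ (outside ∷ I) (suc i)
            bound i∈I (yes refl) le = ℕ.s≤s⁻¹ (subst₂ ℕ._≤_ (lookup∘updateAt i₀ b)
              (degree-v I free i∈I refl) le)
            bound i∈I (no neq)   le = subst₂ ℕ._≤_ (same neq) (degree-other I free i∈I neq) le

sum-updateAt-suc : ∀ {n} (a : Vec ℕ n) i → Vec.sum (updateAt a i suc) ≡ suc (Vec.sum a)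
sum-updateAt-suc (x ∷ a) zero    = refl
sum-updateAt-suc (x ∷ a) (suc i) = trans (cong (x ℕ.+_) (sum-updateAt-suc a i)) (ℕ.+-suc x (Vec.sum a))

length≤sum : ∀ {n} (a : Vec ℕ n) → (∀ i → 1 ℕ.≤ lookup a i) → n ℕ.≤ Vec.sum a
length≤sum []      pos = ℕ.z≤n
length≤sum (x ∷ a) pos = ℕ.+-mono-≤ (pos zero) (length≤sum a (pos ∘ suc))

sum-ones : ∀ n → Vec.sum (Vec.replicate n 1) ≡ n
sum-ones zero    = refl
sum-ones (suc n) = cong suc (sum-ones n)

≡-replicate : ∀ {n x} (a : Vec ℕ n) → (∀ i → lookup a i ≡ x) → a ≡ Vec.replicate n x
≡-replicate []      eq = refl
≡-replicate (y ∷ a) eq = cong₂ _∷_ (eq zero) (≡-replicate a (eq ∘ suc))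

-- Enumeration of parking functions along the recursion

module Enumeration (n : ℕ) where
  open Calculus (graphic (suc n))
  open Limit n
  open Rank n
  open Parking {n}

  -- Index j means sum n + j - 2, so the all-ones vector sits at index 2, where `peak` has its 1.
  -- The size is demanded for every stored number e, because a contraction raises it.
  record Listing (s : Labelling {suc n}) (E : List (Edge (suc n))) (j : ℕ) : Set where
    field
      list     : List (Vec ℕ n)
      unique   : Unique list
      sound    : ∀ {a} → a ∈ˡ list → Parks s E a × 2 ℕ.+ Vec.sum a ≡ n ℕ.+ j
      complete : ∀ {a} → Parks s E a → 2 ℕ.+ Vec.sum a ≡ n ℕ.+ j → a ∈ˡ list
      size     : ∀ e → + length list ≡ count spanning E (s , e) j

  open Listing
  open Parks

  no-listing : ∀ {s E j} → (∀ {a} → Parks s E a → 2 ℕ.+ Vec.sum a ≢ n ℕ.+ j) →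
    (∀ e → count spanning E (s , e) j ≡ 0ℤ) → Listing s E j
  no-listing none zero-count = record
    { list = [] ; unique = [] ; sound = λ () ; complete = λ p eq → contradiction eq (none p)
    ; size = λ e → sym (zero-count e) }

  spanning-0 : ∀ s → spanning s 0 ≡ 0ℤ
  spanning-0 s = *-zeroʳ (indicator (top? s))

  too-large : ∀ {s E a} → Parks s E a → 2 ℕ.+ Vec.sum a ≢ n ℕ.+ 0
  too-large {a = a} (parks pos _ _) eq = ℕ.<-irrefl refl (ℕ.≤-trans (ℕ.s≤s (ℕ.≤-trans (length≤sum a pos) (ℕ.n≤1+n _)))
    (ℕ.≤-reflexive (trans eq (ℕ.+-identityʳ n))))

  -- The value at i₀ decides: vectors with value 1 are those of the contraction, with the same sum;
  -- the others arise from those of the deletion by adding 1 at i₀, which lowers the index to j.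
  delcon-listing : ∀ {s e} E₁ E₂ j {r i₀} → Simple s → (root : Root s r) (¬root : ¬ Root s (suc i₀)) →
    e ≡ (r , suc i₀) ⊎ e ≡ (suc i₀ , r) →
    (Simple (merge s (proj₁ e) (proj₂ e)) → Listing (merge s (proj₁ e) (proj₂ e)) (E₁ ++ E₂) (suc j)) →
    Listing s (E₁ ++ E₂) j → Listing s (E₁ ++ e ∷ E₂) (suc j)
  delcon-listing {s} {e} E₁ E₂ j {r} {i₀} simple root ¬root e≡ contracted deleted = record
    { list     = map inc (list deleted) ++ list C
    ; unique   = Unique.++⁺ (Unique.map⁺ inc-injective (unique deleted)) (unique C) disjoint
    ; sound    = λ a∈ → [ sound-delete , sound-contract ]′ (∈-++⁻ (map inc (list deleted)) a∈)
    ; complete = λ {a} p eq → complete′ p eq (lookup a i₀ ℕ.≟ 1)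
    ; size     = size′
    }
    where
    open Absorb simple root ¬root
    t : Labelling {suc n}
    t = merge s (proj₁ e) (proj₂ e)
    v′ : s (proj₁ e) ≢ s (proj₂ e)
    v′ = [ (λ { refl eq → ¬root (trans (sym eq) root) }) , (λ { refl eq → ¬root (trans eq root) }) ]′ e≡
    s⊑t : s ⊑ t
    s⊑t = ⊑-merge s (proj₁ e) (proj₂ e)
    joins : t r ≡ t (suc i₀)
    joins = [ (λ { refl → merge-joins s r (suc i₀) }) , (λ { refl → sym (merge-joins s (suc i₀) r) }) ]′ e≡
    least : ∀ {χ : Labelling {suc n}} → s ⊑ χ → χ r ≡ χ (suc i₀) → t ⊑ χ
    least s⊑χ eq = merge-least s (proj₁ e) (proj₂ e) s⊑χ ([ (λ { refl → eq }) , (λ { refl → sym eq }) ]′ e≡)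
    C : Listing t (E₁ ++ E₂) (suc j)
    C = contracted (Simple-absorb (λ {w} {x} → s⊑t {w} {x}) joins (λ {χ} → least {χ}))
    open Step (λ {w} {x} → s⊑t {w} {x}) joins (λ {χ} → least {χ}) {E₁ ++ e ∷ E₂} {E₁ ++ E₂} (outdegree-shift E₁ e E₂) e≡
    inc : Vec ℕ n → Vec ℕ n
    inc b = updateAt b i₀ suc
    dec : Vec ℕ n → Vec ℕ n
    dec a = updateAt a i₀ ℕ.pred
    dec-inc : ∀ b → dec (inc b) ≡ b
    dec-inc b = trans (updateAt-updateAt-local i₀ {h = id} b refl) (updateAt-id-local i₀ b refl)
    inc-dec : ∀ a → 1 ℕ.≤ lookup a i₀ → inc (dec a) ≡ a
    inc-dec a 1≤ = trans (updateAt-updateAt-local i₀ {h = id} a (ℕ.suc-pred _ {{ℕ.>-nonZero 1≤}}))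
      (updateAt-id-local i₀ a refl)
    inc-injective : ∀ {b b′} → inc b ≡ inc b′ → b ≡ b′
    inc-injective {b} {b′} eq = trans (sym (dec-inc b)) (trans (cong dec eq) (dec-inc b′))
    sum-inc : ∀ b → 2 ℕ.+ Vec.sum b ≡ n ℕ.+ j → 2 ℕ.+ Vec.sum (inc b) ≡ n ℕ.+ suc j
    sum-inc b eq = trans (cong (2 ℕ.+_) (sum-updateAt-suc b i₀)) (trans (cong suc eq) (sym (ℕ.+-suc n j)))
    sum-dec : ∀ b → 2 ℕ.+ Vec.sum (inc b) ≡ n ℕ.+ suc j → 2 ℕ.+ Vec.sum b ≡ n ℕ.+ j
    sum-dec b eq = ℕ.suc-injective
      (trans (sym (cong (2 ℕ.+_) (sum-updateAt-suc b i₀))) (trans eq (ℕ.+-suc n j)))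
    sound-delete : ∀ {a} → a ∈ˡ map inc (list deleted) → _
    sound-delete {a} a∈ with b , b∈ , refl ← ∈-map⁻ inc a∈ =
      delete⇐ (proj₁ (sound deleted b∈)) , sum-inc b (proj₂ (sound deleted b∈))
    sound-contract : ∀ {a} → a ∈ˡ list C → _
    sound-contract {a} a∈ = contract⇐ (proj₁ (sound C a∈)) , proj₂ (sound C a∈)
    complete′ : ∀ {a} → Parks s (E₁ ++ e ∷ E₂) a → 2 ℕ.+ Vec.sum a ≡ n ℕ.+ suc j → Dec (lookup a i₀ ≡ 1) →
      a ∈ˡ map inc (list deleted) ++ list C
    complete′ {a} p eq (yes a≡1) = ∈-++⁺ʳ (map inc (list deleted)) (complete C (contract⇒ p a≡1) eq)
    complete′ {a} p eq (no a≢1) = ∈-++⁺ˡ (subst (_∈ˡ map inc (list deleted)) ia≡a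
      (∈-map⁺ inc (complete deleted (delete⇒ (subst (Parks s _) (sym ia≡a) p) 1≤b)
        (sum-dec (dec a) (subst (λ a → 2 ℕ.+ Vec.sum a ≡ _) (sym ia≡a) eq)))))
      where
      1≤a = atLeast1 p i₀
      ia≡a = inc-dec a 1≤a
      1≤b : 1 ℕ.≤ lookup (dec a) i₀
      1≤b = subst (1 ℕ.≤_) (sym (lookup∘updateAt i₀ a)) (ℕ.pred-mono-≤ (ℕ.≤∧≢⇒< 1≤a (a≢1 ∘ sym)))
    disjoint : ∀ {a} → ¬ (a ∈ˡ map inc (list deleted) × a ∈ˡ list C)
    disjoint {a} (a∈ , a∈′) with b , b∈ , refl ← ∈-map⁻ inc a∈ = ℕ.<-irrefl refl
      (subst (2 ℕ.≤_) (absorbed (proj₁ (sound C a∈′)) i₀ (trans (sym joins) (s⊑t root)))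
        (subst (2 ℕ.≤_) (sym (lookup∘updateAt i₀ b)) (ℕ.s≤s (atLeast1 (proj₁ (sound deleted b∈)) i₀))))
    size′ : ∀ c → + length (map inc (list deleted) ++ list C) ≡ count spanning (E₁ ++ e ∷ E₂) (s , c) (suc j)
    size′ c = begin
      + length (map inc (list deleted) ++ list C)
        ≡⟨ cong +_ (trans (length-++ (map inc (list deleted))) (cong (ℕ._+ length (list C)) (length-map inc (list deleted)))) ⟩
      + (length (list deleted) ℕ.+ length (list C))
        ≡⟨ pos-+ (length (list deleted)) (length (list C)) ⟩
      + length (list deleted) + + length (list C)
        ≡⟨ cong₂ _+_ (size deleted c) (size C (suc c)) ⟩
      count spanning (E₁ ++ E₂) (s , c) j + count spanning (E₁ ++ E₂) (t , suc c) (suc j)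
        ≡⟨ Θ-suc {s , c} {e} (count spanning (E₁ ++ E₂)) j v′ ⟨
      Θ e (count spanning (E₁ ++ E₂)) (s , c) (suc j)
        ≡⟨ count-shift E₁ e E₂ (λ {s} {t} → spanning-resp {s} {t}) (s , c) (suc j) ⟨
      count spanning (E₁ ++ e ∷ E₂) (s , c) (suc j) ∎
      where open ≡-Reasoning

  -- Every contraction stays below χ by `merge-least`, and χ separates w from the root, so no
  -- spanning flat is ever reached.
  disconnected : ∀ {χ : Labelling {suc n}} {w} E {s e} → s ⊑ χ → All (λ (u , v) → χ u ≡ χ v) E → χ w ≢ χ zero →
    ∀ k → count spanning E (s , e) k ≡ 0ℤ
  disconnected {χ} {w} [] {s} {e} s⊑χ [] χ≢ k = cong (_* peak k)
    (indicator-no (top? (s , e)) (λ top → χ≢ (s⊑χ (top w))))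
  disconnected {χ} (f@(u , v) ∷ E) {s} {e} s⊑χ (eq ∷ eqs) χ≢ k = go k (loop? (s , e) f)
    where
    rec : ∀ {s e} → s ⊑ χ → ∀ k → count spanning E (s , e) k ≡ 0ℤ
    rec s⊑χ k = disconnected E s⊑χ eqs χ≢ k
    go : ∀ k → Dec (s u ≡ s v) → count spanning (f ∷ E) (s , e) k ≡ 0ℤ
    go k       (yes l) = trans (Θ-loop {s , e} {f} _ k l) (rec s⊑χ k)
    go zero    (no ¬l) = trans (Θ-zero {s , e} {f} _ ¬l) (rec (merge-least s u v s⊑χ eq) 0)
    go (suc k) (no ¬l) = trans (Θ-suc {s , e} {f} _ k ¬l)
      (cong₂ _+_ (rec s⊑χ k) (rec (merge-least s u v s⊑χ eq) (suc k)))

  Crossing : Labelling {suc n} → Edge (suc n) → Set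
  Crossing s (u , v) = (Root s u × ¬ Root s v) ⊎ (¬ Root s u × Root s v)

  crossing? : ∀ s f → Dec (Crossing s f)
  crossing? s (u , v) = (root? s u ×-dec ¬? (root? s v)) ⊎-dec (¬? (root? s u) ×-dec root? s v)

  -- If the root block is everything, all remaining edges are loops and only the all-ones vector is
  -- left. Otherwise the set I of all vertices outside the block has outdegree 0 at each of its
  -- members, which excludes parking functions, and the same cut makes `count` vanish.
  stuck-listing : ∀ {s} E j → All (λ f → ¬ Crossing s f) E → Dec (∀ w → Root s w) → Listing s E j
  stuck-listing {s} E j ¬cross (yes top) = go j
    where
    ones : ∀ {a} → Parks s E a → a ≡ Vec.replicate n 1
    ones {a} (parks _ one _) = ≡-replicate a (λ i → one i (top (suc i)))
    parks-ones : Parks s E (Vec.replicate n 1)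
    parks-ones = parks (λ i → ℕ.≤-reflexive (sym (lookup-replicate i 1))) (λ i _ → lookup-replicate i 1)
      (λ I (i , i∈I) free → contradiction (top (suc i)) (free i∈I))
    total : ∀ e k → count spanning E (s , e) k ≡ peak k
    total e k = trans (count-loops {s = s , e} E (All.universal (λ (u , v) → trans (top u) (sym (top v))) E) k)
      (trans (cong (_* peak k) (indicator-yes (top? (s , e)) top)) (*-identityˡ (peak k)))
    2≡ : ∀ {a j} → Parks s E a → 2 ℕ.+ Vec.sum a ≡ n ℕ.+ j → 2 ≡ j
    2≡ {a} {j} p eq = ℕ.+-cancelˡ-≡ n 2 j (trans (ℕ.+-comm n 2)
      (trans (cong (2 ℕ.+_) (trans (sym (sum-ones n)) (cong Vec.sum (sym (ones p))))) eq))
    go : ∀ j → Listing s E j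
    go 0 = no-listing (λ p eq → contradiction (2≡ p eq) λ ()) (λ e → total e 0)
    go 1 = no-listing (λ p eq → contradiction (2≡ p eq) λ ()) (λ e → total e 1)
    go 2 = record
      { list     = Vec.replicate n 1 ∷ []
      ; unique   = [] ∷ []
      ; sound    = λ { (here refl) → parks-ones , trans (cong (2 ℕ.+_) (sum-ones n)) (ℕ.+-comm 2 n) }
      ; complete = λ p _ → here (ones p)
      ; size     = λ e → sym (total e 2)
      }
    go (suc (suc (suc j))) = no-listing (λ p eq → contradiction (2≡ p eq) λ ()) (λ e → total e (3 ℕ.+ j))
  stuck-listing {s} E j ¬cross (no ¬top) with ¬∀⟶∃¬ (suc n) (Root s) (root? s) ¬top
  ... | zero  , ¬root = contradiction refl ¬root
  ... | suc i , ¬root = no-listing (λ p _ → blocked p) (λ e → disconnected {χ} {suc i} E s⊑χ χ-edges χ≢ j)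
    where
    χ : Labelling {suc n}
    χ w = if does (root? s w) then zero else suc i
    χ-yes : ∀ {w} → Root s w → χ w ≡ zero
    χ-yes {w} p with root? s w
    ... | yes _ = refl
    ... | no ¬p = contradiction p ¬p
    χ-no : ∀ {w} → ¬ Root s w → χ w ≡ suc i
    χ-no {w} ¬p with root? s w
    ... | yes p = contradiction p ¬p
    ... | no _  = refl
    χ≢ : χ (suc i) ≢ χ zero
    χ≢ eq = contradiction (trans (sym (χ-no ¬root)) (trans eq (χ-yes {zero} refl))) λ ()
    s⊑χ : s ⊑ χ
    s⊑χ {w} {x} eq with root? s w
    ... | yes p = sym (χ-yes (trans (sym eq) p))
    ... | no ¬p = sym (χ-no (λ q → ¬p (trans eq q)))
    χ-edges : All (λ (u , v) → χ u ≡ χ v) E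
    χ-edges = All.map (λ {(u , v)} → same u v) ¬cross
      where
      same : ∀ u v → ¬ Crossing s (u , v) → χ u ≡ χ v
      same u v ¬c with root? s u | root? s v
      ... | yes _ | yes _ = refl
      ... | no _  | no _  = refl
      ... | yes p | no ¬q = contradiction (inj₁ (p , ¬q)) ¬c
      ... | no ¬p | yes q = contradiction (inj₂ (¬p , q)) ¬c
    I : Subset n
    I = tabulate (λ k → does (¬? (root? s (suc k))))
    I-sound : ∀ {k} → k ∈ I → ¬ Root s (suc k)
    I-sound {k} k∈ p with root? s (suc k) | trans (sym (lookup∘tabulate (λ k → does (¬? (root? s (suc k)))) k)) ([]=⇒lookup k∈)
    ... | yes _ | ()
    ... | no ¬p | _ = ¬p p
    I-complete : ∀ {k} → ¬ Root s (suc k) → k ∈ I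
    I-complete {k} ¬p = lookup⇒[]= k I (trans (lookup∘tabulate _ k) (true-no (root? s (suc k))))
      where
      true-no : (d : Dec (Root s (suc k))) → does (¬? d) ≡ true
      true-no (yes p) = contradiction p ¬p
      true-no (no _)  = refl
    out-0 : ∀ w → ¬ Root s w → out (outside ∷ I) w ≡ 0
    out-0 zero    ¬p = contradiction refl ¬p
    out-0 (suc k) ¬p = cong (λ b → if b then 0 else 1) ([]=⇒lookup (I-complete ¬p))
    link-0 : ∀ x → ¬ Root s x → ∀ u v → ¬ Crossing s (u , v) → link (outside ∷ I) x (u , v) ≡ 0
    link-0 x ¬p u v ¬c = cong₂ ℕ._+_ (side u v (λ ¬u q → ¬c (inj₂ (¬u , q)))) (side v u (λ ¬v q → ¬c (inj₁ (q , ¬v))))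
      where
      side : ∀ u v → (¬ Root s u → ¬ Root s v) → when (x ≟ᶠ u) (out (outside ∷ I) v) ≡ 0
      side u v far with x ≟ᶠ u
      ... | yes refl = out-0 v (far ¬p)
      ... | no _     = refl
    outdegree-0 : ∀ x → ¬ Root s x → ∀ {E} → All (λ f → ¬ Crossing s f) E → outdegree E (outside ∷ I) x ≡ 0
    outdegree-0 x ¬p []                     = refl
    outdegree-0 x ¬p (_∷_ {u , v} ¬c ¬cs) = cong₂ ℕ._+_ (link-0 x ¬p u v ¬c) (outdegree-0 x ¬p ¬cs)
    blocked : ∀ {a} → ¬ Parks s E a
    blocked {a} (parks pos _ park) = let k , k∈I , le = park I (i , I-complete ¬root) I-sound in
      ℕ.<-irrefl refl (ℕ.≤-trans (pos k) (subst (lookup a k ℕ.≤_) (outdegree-0 (suc k) (I-sound k∈I) ¬cross) le))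

  -- ℓ carries the recursion, as E₁ ++ E₂ is no subterm of the edge list. Edges that do not leave
  -- the root block stay in the list until no crossing edge is left.
  listing : ∀ ℓ E → length E ℕ.≤ ℓ → ∀ s → Simple s → ∀ j → Listing s E j
  listing ℓ E len s simple zero = no-listing too-large (λ e → count-0 E 0 spanning-0 spanning-0 ℕ.z≤n (s , e))
  listing ℓ E len s simple (suc j) with Any.any? (crossing? s) E
  ... | no ¬any = stuck-listing E (suc j) (¬Any⇒All¬ E ¬any) (all? (root? s))
  ... | yes any with find any
  ...   | e , e∈E , cross with ∈-∃++ e∈E
  ...     | E₁ , E₂ , refl = go ℓ (subst (ℕ._≤ ℓ) removed len) e cross
    where
    removed : length (E₁ ++ e ∷ E₂) ≡ suc (length (E₁ ++ E₂))
    removed = trans (length-++ E₁) (trans (ℕ.+-suc (length E₁) (length E₂)) (cong suc (sym (length-++ E₁))))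
    go : ∀ ℓ → suc (length (E₁ ++ E₂)) ℕ.≤ ℓ → ∀ e → Crossing s e → Listing s (E₁ ++ e ∷ E₂) (suc j)
    go (suc ℓ) (ℕ.s≤s le) = λ
      { (u , zero)  (inj₁ (p , ¬q)) → contradiction refl ¬q
      ; (u , suc i) (inj₁ (p , ¬q)) → delcon-listing E₁ E₂ j simple p ¬q (inj₁ refl) contracted deleted
      ; (zero , v)  (inj₂ (¬p , q)) → contradiction refl ¬p
      ; (suc i , v) (inj₂ (¬p , q)) → delcon-listing E₁ E₂ j simple q ¬p (inj₂ refl) contracted deleted
      }
      where
      deleted : Listing s (E₁ ++ E₂) j
      deleted = listing ℓ (E₁ ++ E₂) le s simple j
      contracted : ∀ {t} → Simple t → Listing t (E₁ ++ E₂) (suc j)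
      contracted {t} simple′ = listing ℓ (E₁ ++ E₂) le t simple′ (suc j)

-- The coefficients of P_G

boxVecs-complete : ∀ n b (a : Vec ℕ n) → (∀ i → 1 ℕ.≤ lookup a i) → (∀ i → lookup a i ℕ.≤ b i) → a ∈ˡ boxVecs n b
boxVecs-complete zero    b []            pos bound = here refl
boxVecs-complete (suc n) b (zero  ∷ a)   pos bound = contradiction (pos zero) λ ()
boxVecs-complete (suc n) b (suc x ∷ a)   pos bound = ∈-concatMap⁺ (λ x → map (x ∷_) (boxVecs n (b ∘ suc)))
  (lose (∈-map⁺ suc (∈-upTo⁺ (bound zero)))
        (∈-map⁺ (suc x ∷_) (boxVecs-complete n (b ∘ suc) a (pos ∘ suc) (bound ∘ suc))))

concatMap-∷-unique : ∀ {n} {xs : List ℕ} {as : List (Vec ℕ n)} → Unique xs → Unique as →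
  Unique (concatMap (λ x → map (x ∷_) as) xs)
concatMap-∷-unique []                    u = []
concatMap-∷-unique {xs = x ∷ xs} {as} (x∉ ∷ ux) u =
  Unique.++⁺ (Unique.map⁺ ∷-injectiveʳ u) (concatMap-∷-unique ux u) disjoint
  where
  disjoint : ∀ {a} → ¬ (a ∈ˡ map (x ∷_) as × a ∈ˡ concatMap (λ x → map (x ∷_) as) xs)
  disjoint (a∈ , a∈′) with _ , _ , refl ← ∈-map⁻ (x ∷_) a∈
    with y , y∈ , a∈y ← find (∈-concatMap⁻ (λ x → map (x ∷_) as) {xs = xs} a∈′)
    with _ , _ , eq ← ∈-map⁻ (y ∷_) a∈y = All.lookup x∉ y∈ (proj₁ (∷-injective eq))

boxVecs-unique : ∀ n b → Unique (boxVecs n b)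
boxVecs-unique zero    b = [] ∷ []
boxVecs-unique (suc n) b = concatMap-∷-unique
  (Unique.map⁺ ℕ.suc-injective (Unique.upTo⁺ (b zero))) (boxVecs-unique n (b ∘ suc))

sum-tabulate-mono : ∀ {N} {f g : Fin N → ℕ} → (∀ w → f w ℕ.≤ g w) →
  Vec.sum (tabulate f) ℕ.≤ Vec.sum (tabulate g)
sum-tabulate-mono {zero}  le = ℕ.z≤n
sum-tabulate-mono {suc N} le = ℕ.+-mono-≤ (le zero) (sum-tabulate-mono (le ∘ suc))

module _ {n : ℕ} (G : Multigraph n) where
  open Calculus (graphic (suc n))
  open Limit n
  open Rank n
  open Parking {n}
  open Enumeration n
  open Listing

  dOut≤deg : ∀ I i → dOut G I i ℕ.≤ deg G i
  dOut≤deg I i = ℕ.+-monoʳ-≤ (mult G (suc i) zero) (sum-tabulate-mono (λ j → bound (lookup I j)))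
    where
    bound : ∀ {m} b → (if b then 0 else m) ℕ.≤ m
    bound true  = ℕ.z≤n
    bound false = ℕ.≤-refl

  parking≤deg : ∀ {a} → IsParking G a → ∀ i → lookup a i ℕ.≤ deg G i
  parking≤deg {a} (_ , park) i with j , j∈ , le ← park ⁅ i ⁆ (i , x∈⁅x⁆ i) =
    subst (λ j → lookup a j ℕ.≤ deg G j) (x∈⁅y⁆⇒x≡y i j∈) (ℕ.≤-trans le (dOut≤deg ⁅ i ⁆ j))

  graphEdges : List (Edge (suc n))
  graphEdges = edges (mult G)

  outdegree≡dOut : ∀ I i → outdegree graphEdges (outside ∷ I) (suc i) ≡ dOut G I i
  outdegree≡dOut I i = outdegree-edges (mult G) (symmetric G) (loopless G) (outside ∷ I) (suc i)

  Parks⇒IsParking : ∀ {a} → Parks id graphEdges a → IsParking G a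
  Parks⇒IsParking {a} (parks pos _ park) = pos , λ I ne → let i , i∈I , le = park I ne (λ _ ()) in
    i , i∈I , subst (lookup a i ℕ.≤_) (outdegree≡dOut I i) le

  IsParking⇒Parks : ∀ {a} → IsParking G a → Parks id graphEdges a
  IsParking⇒Parks {a} (pos , park) = parks pos (λ _ ()) λ I ne _ → let i , i∈I , le = park I ne in
    i , i∈I , subst (lookup a i ℕ.≤_) (sym (outdegree≡dOut I i)) le

  parkingList : ℕ → List (Vec ℕ n)
  parkingList k = filter (λ a → parking? G a ×-dec (Vec.sum a ℕ.≟ k)) (boxVecs n (deg G))

  -- The filtered box and the list built by the recursion are both free of duplicates and have the
  -- same members, hence the same length. The identity labelling is the state in which only vertex 0
  -- has been absorbed.
  coeffP-shift : ∀ k → + coeffP G (n ℕ.+ k) ≡ count spanning graphEdges (id , 0) (2 ℕ.+ k)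
  coeffP-shift k = trans (cong +_ (↭-length (∼bag⇒↭ (unique∧set⇒bag
      (Unique.filter⁺ P? (boxVecs-unique n (deg G))) (unique L) (mk⇔ to from))))) (size L 0)
    where
    P? = λ a → parking? G a ×-dec (Vec.sum a ℕ.≟ n ℕ.+ k)
    L : Listing id graphEdges (2 ℕ.+ k)
    L = listing (length graphEdges) graphEdges ℕ.≤-refl id inj₂ (2 ℕ.+ k)
    shift : n ℕ.+ (2 ℕ.+ k) ≡ 2 ℕ.+ (n ℕ.+ k)
    shift = trans (ℕ.+-suc n (suc k)) (cong suc (ℕ.+-suc n k))
    to : ∀ {a} → a ∈ˡ parkingList (n ℕ.+ k) → a ∈ˡ list L
    to a∈ with _ , p , eq ← ∈-filter⁻ P? {xs = boxVecs n (deg G)} a∈ =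
      complete L (IsParking⇒Parks p) (trans (cong (2 ℕ.+_) eq) (sym shift))
    from : ∀ {a} → a ∈ˡ list L → a ∈ˡ parkingList (n ℕ.+ k)
    from {a} a∈ = let p , eq = sound L a∈ ; q = Parks⇒IsParking p in
      ∈-filter⁺ P? (boxVecs-complete n (deg G) a (proj₁ q) (parking≤deg {a} q))
        (q , ℕ.+-cancelˡ-≡ 2 _ _ (trans eq shift))

  coeffP-small : ∀ {k} → k ℕ.< n → coeffP G k ≡ 0
  coeffP-small {k} k<n = empty (parkingList k) λ {a} a∈ →
    let _ , (pos , _) , eq = ∈-filter⁻ (λ a → parking? G a ×-dec (Vec.sum a ℕ.≟ k)) {xs = boxVecs n (deg G)} a∈ in
    ℕ.<-irrefl refl (ℕ.<-≤-trans k<n (subst (n ℕ.≤_) eq (length≤sum a pos)))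
    where
    empty : (as : List (Vec ℕ n)) → (∀ {a} → ¬ (a ∈ˡ as)) → length as ≡ 0
    empty []       none = refl
    empty (a ∷ as) none = contradiction (here refl) none

  log-concave-coeffP : LogConcave (coeffP G)
  log-concave-coeffP k with n ℕ.≤? k
  ... | no n≰k = subst (λ c → c ℕ.* coeffP G (2 ℕ.+ k) ℕ.≤ coeffP G (1 ℕ.+ k) ℕ.* coeffP G (1 ℕ.+ k))
    (sym (coeffP-small (ℕ.≰⇒> n≰k))) ℕ.z≤n
  ... | yes n≤k with l , refl ← ℕ.m≤n⇒∃[o]m+o≡n n≤k = drop‿+≤+ (begin
    + (coeffP G (n ℕ.+ l) ℕ.* coeffP G (2 ℕ.+ (n ℕ.+ l)))
      ≡⟨ pos-* (coeffP G (n ℕ.+ l)) _ ⟩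
    + coeffP G (n ℕ.+ l) * + coeffP G (2 ℕ.+ (n ℕ.+ l))
      ≡⟨ cong₂ _*_ (coeffP-shift l) (trans (cong (λ k → + coeffP G k) shift₂) (coeffP-shift (2 ℕ.+ l))) ⟩
    count spanning graphEdges (id , 0) (2 ℕ.+ l) * count spanning graphEdges (id , 0) (4 ℕ.+ l)
      ≤⟨ log-concave-spanning graphEdges Ranked-id (2 ℕ.+ l) ⟩
    count spanning graphEdges (id , 0) (3 ℕ.+ l) * count spanning graphEdges (id , 0) (3 ℕ.+ l)
      ≡⟨ cong (λ c → c * c) (trans (cong (λ k → + coeffP G k) shift₁) (coeffP-shift (1 ℕ.+ l))) ⟨
    + coeffP G (1 ℕ.+ (n ℕ.+ l)) * + coeffP G (1 ℕ.+ (n ℕ.+ l))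
      ≡⟨ pos-* (coeffP G (1 ℕ.+ (n ℕ.+ l))) _ ⟨
    + (coeffP G (1 ℕ.+ (n ℕ.+ l)) ℕ.* coeffP G (1 ℕ.+ (n ℕ.+ l))) ∎)
    where
    open ≤-Reasoning
    shift₁ : 1 ℕ.+ (n ℕ.+ l) ≡ n ℕ.+ (1 ℕ.+ l)
    shift₁ = sym (ℕ.+-suc n l)
    shift₂ : 2 ℕ.+ (n ℕ.+ l) ≡ n ℕ.+ (2 ℕ.+ l)
    shift₂ = trans (cong suc shift₁) (sym (ℕ.+-suc n (suc l)))

theorem3p3 : ∀ (n : ℕ) (G : Multigraph n) → Connected G → LogConcave (coeffP G)
theorem3p3 n G _ = log-concave-coeffP G
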